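{- Let $T$ be a $\Delta_1$-definable, $\Sigma_1$-sound arithmetic theory stronger than $\mathsf{R}_0$ (i.e. $T$ proves every axiom of $\mathsf{R}_0$). Then $T$ is incomplete; that is, there exists an arithmetic sentence $\varphi$ such that $T \nvdash \varphi$ and $T \nvdash \neg\varphi$.
   Context: An arithmetic sentence (theory) is a first-order sentence (set of sentences) in the language $\mathcal{L}_{\mathrm{OR}}=\{0,1,+,\cdot,<,=\}$; $\overline{n}$ is the numeral of $n\in\mathbb{N}$. The theory $\mathsf{R}_0$ consists of the equality axioms for $\mathcal{L}_{\mathrm{OR}}$ together with: $\overline{n}+\overline{m}=\overline{n+m}$ and $\overline{n}\cdot\overline{m}=\overline{n\cdot m}$ for all $n,m\in\mathbb{N}$; $\overline{n}\neq\overline{m}$ for all $n\ne m$ in $\mathbb{N}$; and $\forall x\,[x<\overline{n}\leftrightarrow\bigvee_{i<n}(x=\overline{i})]$ for all $n\in\mathbb{N}$. $T$ is $\Delta_1$-definable if its set of axioms (via Gödel numbers) is defined by a $\Delta_1$-formula of arithmetic (in the usual sense, $\Delta_1$ provably in $\mathsf{I}\Sigma_1$). $T$ is $\Sigma_1$-sound if every $\Sigma_1$-sentence provable in $T$ is true in the standard model $\mathbb{N}$. -}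

module Defs where

open import Level using (Level; 0ℓ)
open import Data.Nat using (ℕ; zero; suc; _+_; _*_; _<_)
open import Data.Fin using (Fin; zero; suc; toℕ)
open import Data.Vec using (Vec; []; _∷_; lookup)
open import Data.List using (List; []; _∷_; map; foldr; upTo)
open import Data.List.Membership.Propositional using () renaming (_∈_ to _∈ˡ_)
open import Data.Product using (∃-syntax; _×_)
open import Data.Empty using (⊥)
open import Function.Bundles using (_⇔_)
open import Relation.Nullary using (¬_)
open import Relation.Unary using (Pred; _∈_; _⊆_)
open import Relation.Binary.PropositionalEquality using (_≡_; _≢_)

infixl 7 _⊗_
infixl 6 _⊕_
infix  5 _≐_ _≺_
infixr 4 _∧'_
infixr 3 _∨'_
infixr 2 _⇒_
infix  1 _⇔'_
infix  8 ¬'_ ∀'_ ∃'_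

-- De Bruijn indices: all free variables are among the n variables in scope.
data Term (n : ℕ) : Set where
  var     : Fin n → Term n
  𝟎 𝟏     : Term n
  _⊕_ _⊗_ : Term n → Term n → Term n

data Formula (n : ℕ) : Set where
  _≐_ _≺_ : Term n → Term n → Formula n
  ⊥'      : Formula n
  _⇒_     : Formula n → Formula n → Formula n
  ∀'_     : Formula (suc n) → Formula n

Sentence : Set
Sentence = Formula 0

Theory : (ℓ : Level) → Set (Level.suc ℓ)
Theory ℓ = Pred Sentence ℓ

-- The logic is classical, so the remaining connectives are abbreviations.
¬'_ : ∀ {n} → Formula n → Formula n
¬' φ = φ ⇒ ⊥'

_∧'_ _∨'_ _⇔'_ : ∀ {n} → Formula n → Formula n → Formula n
φ ∧' ψ = ¬' (φ ⇒ ¬' ψ)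
φ ∨' ψ = ¬' φ ⇒ ψ
φ ⇔' ψ = (φ ⇒ ψ) ∧' (ψ ⇒ φ)

∃'_ : ∀ {n} → Formula (suc n) → Formula n
∃' φ = ¬' ∀' ¬' φ

⋁ : ∀ {n} → List (Formula n) → Formula n
⋁ = foldr _∨'_ ⊥'

∀* : ∀ {n} → Formula n → Sentence
∀* {zero}  φ = φ
∀* {suc n} φ = ∀* (∀' φ)

-- The numeral of 1 is the constant 1 rather than 0 + 1; otherwise R₀ would
-- say nothing about the constant 1.
numeral : ∀ {n} → ℕ → Term n
numeral zero          = 𝟎
numeral (suc zero)    = 𝟏
numeral (suc (suc k)) = numeral (suc k) ⊕ 𝟏

Subst : ℕ → ℕ → Set
Subst n m = Fin n → Term m

substₜ : ∀ {n m} → Subst n m → Term n → Term m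
substₜ σ (var i) = σ i
substₜ σ 𝟎       = 𝟎
substₜ σ 𝟏       = 𝟏
substₜ σ (s ⊕ t) = substₜ σ s ⊕ substₜ σ t
substₜ σ (s ⊗ t) = substₜ σ s ⊗ substₜ σ t

shiftₜ : ∀ {n} → Term n → Term (suc n)
shiftₜ = substₜ (λ i → var (suc i))

lift : ∀ {n m} → Subst n m → Subst (suc n) (suc m)
lift σ zero    = var zero
lift σ (suc i) = shiftₜ (σ i)

subst : ∀ {n m} → Subst n m → Formula n → Formula m
subst σ (s ≐ t) = substₜ σ s ≐ substₜ σ t
subst σ (s ≺ t) = substₜ σ s ≺ substₜ σ t
subst σ ⊥'      = ⊥'
subst σ (φ ⇒ ψ) = subst σ φ ⇒ subst σ ψ
subst σ (∀' φ)  = ∀' subst (lift σ) φ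

shift : ∀ {n} → Formula n → Formula (suc n)
shift = subst (λ i → var (suc i))

embed : ∀ {n} → Sentence → Formula n
embed = subst (λ ())

infix 9 _[_]

inst : ∀ {n} → Term n → Subst (suc n) n
inst t zero    = t
inst t (suc i) = var i

_[_] : ∀ {n} → Formula (suc n) → Term n → Formula n
φ [ t ] = subst (inst t) φ

-- φ(x) ↦ φ(x + 1), where x is the most recently bound variable.
next : ∀ {n} → Formula (suc n) → Formula (suc n)
next {n} = subst incr
  where
  incr : Subst (suc n) (suc n)
  incr zero    = var zero ⊕ 𝟏
  incr (suc i) = var (suc i)

-- Classical natural deduction.  Equality is not built into the logic: the
-- equality axioms belong to the theories below.

infix 0 _∣_⊢_ _⊢_

data _∣_⊢_ {ℓ} (T : Theory ℓ) {n : ℕ} :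
           List (Formula n) → Formula n → Set ℓ where
  ax  : ∀ {Γ φ}   → φ ∈ T → T ∣ Γ ⊢ embed φ
  hyp : ∀ {Γ φ}   → φ ∈ˡ Γ → T ∣ Γ ⊢ φ
  ⇒I  : ∀ {Γ φ ψ} → T ∣ φ ∷ Γ ⊢ ψ → T ∣ Γ ⊢ φ ⇒ ψ
  ⇒E  : ∀ {Γ φ ψ} → T ∣ Γ ⊢ φ ⇒ ψ → T ∣ Γ ⊢ φ → T ∣ Γ ⊢ ψ
  raa : ∀ {Γ φ}   → T ∣ ¬' φ ∷ Γ ⊢ ⊥' → T ∣ Γ ⊢ φ
  ∀I  : ∀ {Γ φ}   → T ∣ map shift Γ ⊢ φ → T ∣ Γ ⊢ ∀' φ
  ∀E  : ∀ {Γ φ}   → T ∣ Γ ⊢ ∀' φ → (t : Term n) → T ∣ Γ ⊢ φ [ t ]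

_⊢_ : ∀ {ℓ} → Theory ℓ → Sentence → Set ℓ
T ⊢ φ = T ∣ [] ⊢ φ

StrongerThan : ∀ {ℓ ℓ'} → Theory ℓ → Theory ℓ' → Set (ℓ Level.⊔ ℓ')
StrongerThan T U = U ⊆ (T ⊢_)

evalₜ : ∀ {n} → Vec ℕ n → Term n → ℕ
evalₜ ρ (var i) = lookup ρ i
evalₜ ρ 𝟎       = 0
evalₜ ρ 𝟏       = 1
evalₜ ρ (s ⊕ t) = evalₜ ρ s + evalₜ ρ t
evalₜ ρ (s ⊗ t) = evalₜ ρ s * evalₜ ρ t

infix 0 _⊨_ ℕ⊨_

-- Since atomic formulas are decidable and ∨, ∃ are classical abbreviations,
-- φ and ¬ ¬ φ have the same truth value, as classical semantics requires.
_⊨_ : ∀ {n} → Vec ℕ n → Formula n → Set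
ρ ⊨ s ≐ t = evalₜ ρ s ≡ evalₜ ρ t
ρ ⊨ s ≺ t = evalₜ ρ s < evalₜ ρ t
ρ ⊨ ⊥'    = ⊥
ρ ⊨ φ ⇒ ψ = (ρ ⊨ φ) → (ρ ⊨ ψ)
ρ ⊨ ∀' φ  = (a : ℕ) → a ∷ ρ ⊨ φ

ℕ⊨_ : Sentence → Set
ℕ⊨ φ = [] ⊨ φ

data Δ₀ {n : ℕ} : Formula n → Set where
  eq   : (s t : Term n) → Δ₀ (s ≐ t)
  lt   : (s t : Term n) → Δ₀ (s ≺ t)
  bot  : Δ₀ ⊥'
  imp  : ∀ {φ ψ} → Δ₀ φ → Δ₀ ψ → Δ₀ (φ ⇒ ψ)
  ball : ∀ {φ} (t : Term n) → Δ₀ φ → Δ₀ (∀' (var zero ≺ shiftₜ t ⇒ φ))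
  bex  : ∀ {φ} (t : Term n) → Δ₀ φ → Δ₀ (∃' (var zero ≺ shiftₜ t ∧' φ))

-- Prenex classes: a block of like quantifiers in front of a Δ₀ formula.
data Σ₁ {n : ℕ} : Formula n → Set where
  base : ∀ {φ} → Δ₀ φ → Σ₁ φ
  ex   : ∀ {φ} → Σ₁ φ → Σ₁ (∃' φ)

data Π₁ {n : ℕ} : Formula n → Set where
  base : ∀ {φ} → Δ₀ φ → Π₁ φ
  all  : ∀ {φ} → Π₁ φ → Π₁ (∀' φ)

pattern x₀ = var zero
pattern x₁ = var (suc zero)
pattern x₂ = var (suc (suc zero))
pattern x₃ = var (suc (suc (suc zero)))

data Equality : Theory 0ℓ where
  ≐-refl  : Equality (∀* {1} (x₀ ≐ x₀))
  ≐-sym   : Equality (∀* {2} (x₀ ≐ x₁ ⇒ x₁ ≐ x₀))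
  ≐-trans : Equality (∀* {3} (x₀ ≐ x₁ ⇒ x₁ ≐ x₂ ⇒ x₀ ≐ x₂))
  ⊕-cong  : Equality (∀* {4} (x₀ ≐ x₁ ⇒ x₂ ≐ x₃ ⇒ x₀ ⊕ x₂ ≐ x₁ ⊕ x₃))
  ⊗-cong  : Equality (∀* {4} (x₀ ≐ x₁ ⇒ x₂ ≐ x₃ ⇒ x₀ ⊗ x₂ ≐ x₁ ⊗ x₃))
  ≺-cong  : Equality (∀* {4} (x₀ ≐ x₁ ⇒ x₂ ≐ x₃ ⇒ x₀ ≺ x₂ ⇒ x₁ ≺ x₃))

data R₀ : Theory 0ℓ where
  equality : ∀ {φ} → φ ∈ Equality → R₀ φ
  ⊕-num    : ∀ n m → R₀ (numeral n ⊕ numeral m ≐ numeral (n + m))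
  ⊗-num    : ∀ n m → R₀ (numeral n ⊗ numeral m ≐ numeral (n * m))
  ≐-num    : ∀ n m → n ≢ m → R₀ (¬' (numeral n ≐ numeral m))
  ≺-num    : ∀ n → R₀ (∀' (x₀ ≺ numeral n ⇔'
                           ⋁ (map (λ i → x₀ ≐ numeral i) (upTo n))))

-- Robinson arithmetic, with x + 1 as the successor of x, together with
-- induction for Σ₁ formulas with parameters.
data IΣ₁ : Theory 0ℓ where
  equality  : ∀ {φ} → φ ∈ Equality → IΣ₁ φ
  suc-≢0    : IΣ₁ (∀* {1} (¬' (x₀ ⊕ 𝟏 ≐ 𝟎)))
  suc-inj   : IΣ₁ (∀* {2} (x₀ ⊕ 𝟏 ≐ x₁ ⊕ 𝟏 ⇒ x₀ ≐ x₁))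
  pred      : IΣ₁ (∀* {1} (¬' (x₀ ≐ 𝟎) ⇒ ∃' (x₁ ≐ x₀ ⊕ 𝟏)))
  ⊕-zero    : IΣ₁ (∀* {1} (x₀ ⊕ 𝟎 ≐ x₀))
  ⊕-suc     : IΣ₁ (∀* {2} (x₀ ⊕ (x₁ ⊕ 𝟏) ≐ (x₀ ⊕ x₁) ⊕ 𝟏))
  ⊗-zero    : IΣ₁ (∀* {1} (x₀ ⊗ 𝟎 ≐ 𝟎))
  ⊗-suc     : IΣ₁ (∀* {2} (x₀ ⊗ (x₁ ⊕ 𝟏) ≐ (x₀ ⊗ x₁) ⊕ x₀))
  ≺-def     : IΣ₁ (∀* {2} (x₀ ≺ x₁ ⇔' ∃' (x₁ ⊕ (x₀ ⊕ 𝟏) ≐ x₂)))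
  induction : ∀ {n} (φ : Formula (suc n)) → Σ₁ φ →
              IΣ₁ (∀* (φ [ 𝟎 ] ∧' ∀' (φ ⇒ next φ) ⇒ ∀' φ))

-- Injective: a ≤ a + b, so the value lies between (a + b)² and (a + b + 1)² - 1.
⟪_,_⟫ : ℕ → ℕ → ℕ
⟪ a , b ⟫ = (a + b) * (a + b) + a

⌜_⌝ₜ : ∀ {n} → Term n → ℕ
⌜ var i ⌝ₜ = ⟪ 0 , toℕ i ⟫
⌜ 𝟎 ⌝ₜ     = ⟪ 1 , 0 ⟫
⌜ 𝟏 ⌝ₜ     = ⟪ 2 , 0 ⟫
⌜ s ⊕ t ⌝ₜ = ⟪ 3 , ⟪ ⌜ s ⌝ₜ , ⌜ t ⌝ₜ ⟫ ⟫
⌜ s ⊗ t ⌝ₜ = ⟪ 4 , ⟪ ⌜ s ⌝ₜ , ⌜ t ⌝ₜ ⟫ ⟫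

⌜_⌝ : ∀ {n} → Formula n → ℕ
⌜ ⊥' ⌝    = ⟪ 0 , 0 ⟫
⌜ s ≐ t ⌝ = ⟪ 1 , ⟪ ⌜ s ⌝ₜ , ⌜ t ⌝ₜ ⟫ ⟫
⌜ s ≺ t ⌝ = ⟪ 2 , ⟪ ⌜ s ⌝ₜ , ⌜ t ⌝ₜ ⟫ ⟫
⌜ φ ⇒ ψ ⌝ = ⟪ 3 , ⟪ ⌜ φ ⌝ , ⌜ ψ ⌝ ⟫ ⟫
⌜ ∀' φ ⌝  = ⟪ 4 , ⌜ φ ⌝ ⟫

-- A Δ₁ formula is a Σ₁ formula that is equivalent in IΣ₁ to a Π₁ formula; it
-- defines the set of Gödel numbers of the axioms of T.
Δ₁-Definable : ∀ {ℓ} → Theory ℓ → Set ℓ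
Δ₁-Definable T =
  ∃[ σ ] ∃[ π ] Σ₁ σ × Π₁ π × (IΣ₁ ⊢ ∀' (σ ⇔' π)) ×
    (∀ a → (a ∷ [] ⊨ σ) ⇔ (∃[ φ ] φ ∈ T × ⌜ φ ⌝ ≡ a))

Σ₁-Sound : ∀ {ℓ} → Theory ℓ → Set ℓ
Σ₁-Sound T = ∀ φ → Σ₁ φ → T ⊢ φ → ℕ⊨ φ

Incomplete : ∀ {ℓ} → Theory ℓ → Set ℓ
Incomplete T = ∃[ φ ] (¬ (T ⊢ φ)) × (¬ (T ⊢ ¬' φ))

{-# OPTIONS --safe #-}
module Submission where

-- Let δ(x) say that the negation of ψ(x̄) is provable in T, where ψ is the
-- formula with Gödel number x.  If δ is Σ₁ then δ(d̄), with d the Gödel number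
-- of δ, is undecidable: Σ₁-soundness of T and Σ₁-completeness of R₀ make each
-- of its proof and its refutation yield the other.
--
-- To see that δ is Σ₁, the syntax and the derivations of T are generated by
-- finitely many Horn clauses whose judgements are tuples of polynomials, and
-- the least fixed point of such a system is Σ₁: a judgement is derivable iff
-- it belongs to a finite set, closed under inference backwards, of judgements
-- with time stamps.  A finite set of numbers u < B is coded by the product of
-- the pairwise coprime numbers 1 + (1 + u) m with m = B !, so that membership
-- is a matter of divisibility.
--
-- Constructively, truth of Σ₁ formulas yields only double negations of
-- derivability, which suffices because the conclusions are negations.

open import Defs
open import Level using (Level; 0ℓ)
open import Data.Nat using (ℕ; zero; suc; _+_; _*_; _<_; _≤_; _⊔_; _!; _<?_; _≟_; s≤s; z≤n; z<s; ≢-nonZero⁻¹)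
open import Data.Nat.Properties using
  ( anyUpTo?; allUpTo?; <-cmp; <-irrefl; <-≤-trans; ≤-trans; <⇒≤; n<1+n
  ; suc-injective; +-comm; +-suc; +-cancelˡ-≡; +-monoʳ-≤; *-mono-≤; m≤m+n; m≤n+m; m<m+n
  ; m≤m*n; m*n≢0; _!≢0; m≤n⇒∃[o]m+o≡n; m≤m⊔n; m≤n⊔m; module ≤-Reasoning )
open import Data.Nat.Divisibility using
  (divides; ∣m+n∣m⇒∣n; ∣n⇒∣m*n; ∣1⇒≡1; ∣-trans; m∣m*n; m≤n⇒m!∣n!) renaming (_∣_ to _∣ℕ_)
open import Data.Nat.Coprimality using (Coprime; coprime-divisor) renaming (sym to coprime-sym)
open import Data.Nat.Induction using (<-wellFounded)
open import Data.Nat.ListAction using (product)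
open import Data.Nat.ListAction.Properties using (∈⇒∣product)
open import Data.Nat.Tactic.RingSolver using (solve-∀)
open import Data.Fin using (Fin; zero; suc; toℕ; fromℕ<; _↑ˡ_; _↑ʳ_)
open import Data.Fin.Patterns using (0F; 1F; 2F; 3F; 4F; 5F; 6F; 7F; 8F)
open import Data.Fin.Properties using (toℕ-injective; toℕ-fromℕ<; toℕ<n)
open import Data.Vec as Vec using (Vec; []; _∷_; lookup; _++_)
open import Data.Vec.Properties using (∷-injective; lookup-++ˡ; lookup-++ʳ)
  renaming (map-∘ to map-∘ᵛ; map-cong to map-congᵛ)
open import Data.Vec.Relation.Unary.All as Allᵛ using ([]; _∷_) renaming (All to Allᵛ)
open import Data.List as List using (List; []; _∷_; map; length; upTo)
open import Data.List.Properties using (map-∘; map-cong; map-id)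
open import Data.List.Membership.Propositional using () renaming (_∈_ to _∈ˡ_)
open import Data.List.Membership.Propositional.Properties using
  (∈-map⁺; ∈-map⁻; ∈-upTo⁺; ∈-upTo⁻; ∈-++⁺ˡ; ∈-++⁺ʳ)
open import Data.List.Relation.Binary.Subset.Propositional using () renaming (_⊆_ to _⊆ˡ_)
open import Data.List.Relation.Binary.Subset.Propositional.Properties using (∷⁺ʳ; map⁺)
open import Data.List.Relation.Unary.All as All using (All; []; _∷_)
open import Data.List.Relation.Unary.All.Properties using (++⁺)
open import Data.List.Relation.Unary.Any using (here; there)
open import Data.Product using (∃; _×_; _,_; proj₁; proj₂; uncurry)
open import Data.Sum using (_⊎_; inj₁; inj₂)
open import Data.Empty using (⊥; ⊥-elim)
open import Data.Unit using (⊤; tt)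
open import Function.Base using (_∘_; id)
open import Function.Bundles using (Equivalence)
open import Induction.WellFounded using (Acc; acc)
open import Relation.Binary.Definitions using (tri<; tri≈; tri>)
open import Relation.Binary.PropositionalEquality
  using (_≡_; _≢_; refl; sym; trans; cong; cong₂; subst₂) renaming (subst to ≡-subst)
open import Relation.Nullary using (¬_; Dec; yes; no)
open import Relation.Nullary.Decidable using (map′; _→-dec_; ¬?; decidable-stable)
open import Relation.Unary using (_⊆_)

private variable
  ℓ ℓ′ : Level
  n m k : ℕ
  E : Set
  env : E → Vec ℕ n


-- Substitution

-- Substitutions are functions, so they are compared pointwise throughout, which avoids function
-- extensionality.
substₜ-cong : {σ τ : Subst n m} → (∀ i → σ i ≡ τ i) → ∀ t → substₜ σ t ≡ substₜ τ t
substₜ-cong e (var i) = e i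
substₜ-cong e 𝟎       = refl
substₜ-cong e 𝟏       = refl
substₜ-cong e (s ⊕ t) = cong₂ _⊕_ (substₜ-cong e s) (substₜ-cong e t)
substₜ-cong e (s ⊗ t) = cong₂ _⊗_ (substₜ-cong e s) (substₜ-cong e t)

substₜ-substₜ : (τ : Subst m k) (σ : Subst n m) → ∀ t →
                substₜ τ (substₜ σ t) ≡ substₜ (substₜ τ ∘ σ) t
substₜ-substₜ τ σ (var i) = refl
substₜ-substₜ τ σ 𝟎       = refl
substₜ-substₜ τ σ 𝟏       = refl
substₜ-substₜ τ σ (s ⊕ t) = cong₂ _⊕_ (substₜ-substₜ τ σ s) (substₜ-substₜ τ σ t)
substₜ-substₜ τ σ (s ⊗ t) = cong₂ _⊗_ (substₜ-substₜ τ σ s) (substₜ-substₜ τ σ t)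

substₜ-var : (t : Term n) → substₜ var t ≡ t
substₜ-var (var i) = refl
substₜ-var 𝟎       = refl
substₜ-var 𝟏       = refl
substₜ-var (s ⊕ t) = cong₂ _⊕_ (substₜ-var s) (substₜ-var t)
substₜ-var (s ⊗ t) = cong₂ _⊗_ (substₜ-var s) (substₜ-var t)

substₜ-numeral : (σ : Subst n m) → ∀ a → substₜ σ (numeral a) ≡ numeral a
substₜ-numeral σ zero          = refl
substₜ-numeral σ (suc zero)    = refl
substₜ-numeral σ (suc (suc a)) = cong (_⊕ 𝟏) (substₜ-numeral σ (suc a))

lift-cong : {σ τ : Subst n m} → (∀ i → σ i ≡ τ i) → ∀ i → lift σ i ≡ lift τ i
lift-cong e zero    = refl
lift-cong e (suc i) = cong shiftₜ (e i)

substₜ-lift-shiftₜ : (σ : Subst n m) → ∀ t →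
                     substₜ (lift σ) (shiftₜ t) ≡ shiftₜ (substₜ σ t)
substₜ-lift-shiftₜ σ t =
  trans (substₜ-substₜ (lift σ) _ t) (sym (substₜ-substₜ _ σ t))

lift-∘ : (τ : Subst m k) (σ : Subst n m) → ∀ i →
         substₜ (lift τ) (lift σ i) ≡ lift (substₜ τ ∘ σ) i
lift-∘ τ σ zero    = refl
lift-∘ τ σ (suc i) = substₜ-lift-shiftₜ τ (σ i)

lift-var : ∀ i → lift {n} var i ≡ var i
lift-var zero    = refl
lift-var (suc i) = refl

substₜ-inst-shiftₜ : (u : Term n) → ∀ t → substₜ (inst u) (shiftₜ t) ≡ t
substₜ-inst-shiftₜ u t = trans (substₜ-substₜ (inst u) _ t) (substₜ-var t)

subst-cong : {σ τ : Subst n m} → (∀ i → σ i ≡ τ i) → ∀ φ → subst σ φ ≡ subst τ φ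
subst-cong e (s ≐ t) = cong₂ _≐_ (substₜ-cong e s) (substₜ-cong e t)
subst-cong e (s ≺ t) = cong₂ _≺_ (substₜ-cong e s) (substₜ-cong e t)
subst-cong e ⊥'      = refl
subst-cong e (φ ⇒ ψ) = cong₂ _⇒_ (subst-cong e φ) (subst-cong e ψ)
subst-cong e (∀' φ)  = cong ∀'_ (subst-cong (lift-cong e) φ)

subst-subst : (τ : Subst m k) (σ : Subst n m) → ∀ φ →
              subst τ (subst σ φ) ≡ subst (substₜ τ ∘ σ) φ
subst-subst τ σ (s ≐ t) = cong₂ _≐_ (substₜ-substₜ τ σ s) (substₜ-substₜ τ σ t)
subst-subst τ σ (s ≺ t) = cong₂ _≺_ (substₜ-substₜ τ σ s) (substₜ-substₜ τ σ t)
subst-subst τ σ ⊥'      = refl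
subst-subst τ σ (φ ⇒ ψ) = cong₂ _⇒_ (subst-subst τ σ φ) (subst-subst τ σ ψ)
subst-subst τ σ (∀' φ)  = cong ∀'_
  (trans (subst-subst (lift τ) (lift σ) φ) (subst-cong (lift-∘ τ σ) φ))

subst-var : (φ : Formula n) → subst var φ ≡ φ
subst-var (s ≐ t) = cong₂ _≐_ (substₜ-var s) (substₜ-var t)
subst-var (s ≺ t) = cong₂ _≺_ (substₜ-var s) (substₜ-var t)
subst-var ⊥'      = refl
subst-var (φ ⇒ ψ) = cong₂ _⇒_ (subst-var φ) (subst-var ψ)
subst-var (∀' φ)  = cong ∀'_ (trans (subst-cong lift-var φ) (subst-var φ))

-- By `subst-subst` both sides are single substitutions, so it suffices to compare them on
-- variables.
subst-comm : {k′ : ℕ} {τ : Subst m k} {σ : Subst n m} {τ′ : Subst k′ k} {σ′ : Subst n k′} →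
             (∀ i → substₜ τ (σ i) ≡ substₜ τ′ (σ′ i)) →
             ∀ φ → subst τ (subst σ φ) ≡ subst τ′ (subst σ′ φ)
subst-comm e φ =
  trans (subst-subst _ _ φ) (trans (subst-cong e φ) (sym (subst-subst _ _ φ)))

subst-embed : (σ : Subst n m) → ∀ φ → subst σ (embed φ) ≡ embed φ
subst-embed σ φ = trans (subst-subst σ _ φ) (subst-cong (λ ()) φ)

subst-inst : (σ : Subst n m) → ∀ φ t →
             subst σ (φ [ t ]) ≡ subst (lift σ) φ [ substₜ σ t ]
subst-inst σ φ t = subst-comm pointwise φ
  where
  pointwise : ∀ i → substₜ σ (inst t i) ≡ substₜ (inst (substₜ σ t)) (lift σ i)
  pointwise zero    = refl
  pointwise (suc i) = sym (substₜ-inst-shiftₜ _ (σ i))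

subst-inst-shift : (t : Term n) → ∀ φ → shift φ [ t ] ≡ φ
subst-inst-shift t φ = trans (subst-subst (inst t) _ φ) (subst-var φ)

-- Splits the variable `zero` off a simultaneous substitution; this is the induction step of
-- `∀*-elim`.
subst-inst-lift : (σ : Subst (suc n) m) → ∀ φ →
                  subst (lift (σ ∘ suc)) φ [ σ zero ] ≡ subst σ φ
subst-inst-lift σ φ = trans (subst-subst _ _ φ) (subst-cong pointwise φ)
  where
  pointwise : ∀ i → substₜ (inst (σ zero)) (lift (σ ∘ suc) i) ≡ σ i
  pointwise zero    = refl
  pointwise (suc i) = substₜ-inst-shiftₜ _ (σ (suc i))

-- Derivations

module _ {T : Theory ℓ} where

  weaken : {Γ Δ : List (Formula n)} {φ : Formula n} →
           Γ ⊆ˡ Δ → T ∣ Γ ⊢ φ → T ∣ Δ ⊢ φ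
  weaken Γ⊆Δ (ax p)   = ax p
  weaken Γ⊆Δ (hyp p)  = hyp (Γ⊆Δ p)
  weaken Γ⊆Δ (⇒I d)   = ⇒I (weaken (∷⁺ʳ _ Γ⊆Δ) d)
  weaken Γ⊆Δ (⇒E d e) = ⇒E (weaken Γ⊆Δ d) (weaken Γ⊆Δ e)
  weaken Γ⊆Δ (raa d)  = raa (weaken (∷⁺ʳ _ Γ⊆Δ) d)
  weaken Γ⊆Δ (∀I d)   = ∀I (weaken (map⁺ shift Γ⊆Δ) d)
  weaken Γ⊆Δ (∀E d t) = ∀E (weaken Γ⊆Δ d) t

  -- Axioms are closed, hence unaffected by `σ`; in the quantifier rules `lift σ` commutes with
  -- shifting and with instantiation.
  subst-⊢ : (σ : Subst n m) {Γ : List (Formula n)} {φ : Formula n} →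
            T ∣ Γ ⊢ φ → T ∣ map (subst σ) Γ ⊢ subst σ φ
  subst-⊢ σ (ax {φ = φ} p) = ≡-subst (T ∣ _ ⊢_) (sym (subst-embed σ φ)) (ax p)
  subst-⊢ σ (hyp p)  = hyp (∈-map⁺ (subst σ) p)
  subst-⊢ σ (⇒I d)   = ⇒I (subst-⊢ σ d)
  subst-⊢ σ (⇒E d e) = ⇒E (subst-⊢ σ d) (subst-⊢ σ e)
  subst-⊢ σ (raa d)  = raa (subst-⊢ σ d)
  subst-⊢ σ (∀I {Γ} {φ} d) = ∀I (≡-subst (T ∣_⊢ _) commute (subst-⊢ (lift σ) d))
    where
    commute : map (subst (lift σ)) (map shift Γ) ≡ map shift (map (subst σ) Γ)
    commute = trans (sym (map-∘ Γ))
      (trans (map-cong (subst-comm λ i → refl) Γ) (map-∘ Γ))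
  subst-⊢ σ (∀E {φ = φ} d t) =
    ≡-subst (T ∣ _ ⊢_) (sym (subst-inst σ φ t)) (∀E (subst-⊢ σ d) (substₜ σ t))

  -- Instantiating all variables at once makes the instances of the R₀ axioms
  -- compute, which iterated single substitution into open terms would not.
  ∀*-elim : {φ : Formula n} → T ⊢ ∀* φ → (σ : Subst n m) {Γ : List (Formula m)} →
            T ∣ Γ ⊢ subst σ φ
  ∀*-elim {zero}          d σ = weaken (λ ()) (subst-⊢ σ d)
  ∀*-elim {suc n} {φ = φ} d σ =
    ≡-subst (T ∣ _ ⊢_) (subst-inst-lift σ φ) (∀E (∀*-elim d (σ ∘ suc)) (σ zero))

⊢-mono : {T : Theory ℓ} {U : Theory ℓ′} → T ⊆ U →
         {Γ : List (Formula n)} {φ : Formula n} → T ∣ Γ ⊢ φ → U ∣ Γ ⊢ φ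
⊢-mono T⊆U (ax p)   = ax (T⊆U p)
⊢-mono T⊆U (hyp p)  = hyp p
⊢-mono T⊆U (⇒I d)   = ⇒I (⊢-mono T⊆U d)
⊢-mono T⊆U (⇒E d e) = ⇒E (⊢-mono T⊆U d) (⊢-mono T⊆U e)
⊢-mono T⊆U (raa d)  = raa (⊢-mono T⊆U d)
⊢-mono T⊆U (∀I d)   = ∀I (⊢-mono T⊆U d)
⊢-mono T⊆U (∀E d t) = ∀E (⊢-mono T⊆U d) t

-- Values and truth under substitution; decidability of Δ₀ formulas

evalₜ-substₜ : {σ : Subst n m} {ρ : Vec ℕ m} {ρ′ : Vec ℕ n} →
               (∀ i → lookup ρ′ i ≡ evalₜ ρ (σ i)) →
               ∀ t → evalₜ ρ (substₜ σ t) ≡ evalₜ ρ′ t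
evalₜ-substₜ e (var i) = sym (e i)
evalₜ-substₜ e 𝟎       = refl
evalₜ-substₜ e 𝟏       = refl
evalₜ-substₜ e (s ⊕ t) = cong₂ _+_ (evalₜ-substₜ e s) (evalₜ-substₜ e t)
evalₜ-substₜ e (s ⊗ t) = cong₂ _*_ (evalₜ-substₜ e s) (evalₜ-substₜ e t)

evalₜ-shiftₜ : ∀ a (ρ : Vec ℕ n) t → evalₜ (a ∷ ρ) (shiftₜ t) ≡ evalₜ ρ t
evalₜ-shiftₜ a ρ = evalₜ-substₜ λ i → refl

evalₜ-numeral : (ρ : Vec ℕ n) → ∀ a → evalₜ ρ (numeral a) ≡ a
evalₜ-numeral ρ zero          = refl
evalₜ-numeral ρ (suc zero)    = refl
evalₜ-numeral ρ (suc (suc a)) =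
  trans (cong (_+ 1) (evalₜ-numeral ρ (suc a))) (+-comm (suc a) 1)

lookup-lift : {σ : Subst n m} {ρ : Vec ℕ m} {ρ′ : Vec ℕ n} →
              (∀ i → lookup ρ′ i ≡ evalₜ ρ (σ i)) →
              ∀ a i → lookup (a ∷ ρ′) i ≡ evalₜ (a ∷ ρ) (lift σ i)
lookup-lift e a zero    = refl
lookup-lift {σ = σ} e a (suc i) = trans (e i) (sym (evalₜ-shiftₜ a _ (σ i)))

-- Both directions are proved together because an implication reverses the direction in its premise.
⊨-subst⁺ : {σ : Subst n m} {ρ : Vec ℕ m} {ρ′ : Vec ℕ n} →
           (∀ i → lookup ρ′ i ≡ evalₜ ρ (σ i)) →
           ∀ φ → ρ′ ⊨ φ → ρ ⊨ subst σ φ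
⊨-subst⁻ : {σ : Subst n m} {ρ : Vec ℕ m} {ρ′ : Vec ℕ n} →
           (∀ i → lookup ρ′ i ≡ evalₜ ρ (σ i)) →
           ∀ φ → ρ ⊨ subst σ φ → ρ′ ⊨ φ
⊨-subst⁺ e (s ≐ t) h = subst₂ _≡_ (sym (evalₜ-substₜ e s)) (sym (evalₜ-substₜ e t)) h
⊨-subst⁺ e (s ≺ t) h = subst₂ _<_ (sym (evalₜ-substₜ e s)) (sym (evalₜ-substₜ e t)) h
⊨-subst⁺ e (φ ⇒ ψ) h = ⊨-subst⁺ e ψ ∘ h ∘ ⊨-subst⁻ e φ
⊨-subst⁺ e (∀' φ)  h = λ a → ⊨-subst⁺ (lookup-lift e a) φ (h a)
⊨-subst⁻ e (s ≐ t) h = subst₂ _≡_ (evalₜ-substₜ e s) (evalₜ-substₜ e t) h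
⊨-subst⁻ e (s ≺ t) h = subst₂ _<_ (evalₜ-substₜ e s) (evalₜ-substₜ e t) h
⊨-subst⁻ e (φ ⇒ ψ) h = ⊨-subst⁻ e ψ ∘ h ∘ ⊨-subst⁺ e φ
⊨-subst⁻ e (∀' φ)  h = λ a → ⊨-subst⁻ (lookup-lift e a) φ (h a)

Δ₀-subst : (σ : Subst n m) {φ : Formula n} → Δ₀ φ → Δ₀ (subst σ φ)
Δ₀-subst σ (eq s t)  = eq _ _
Δ₀-subst σ (lt s t)  = lt _ _
Δ₀-subst σ bot       = bot
Δ₀-subst σ (imp p q) = imp (Δ₀-subst σ p) (Δ₀-subst σ q)
Δ₀-subst σ (ball {φ} t p) =
  -- The constructor demands a bound of the form `shiftₜ t`, so `lift σ` has to be moved past the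
  -- shift.
  ≡-subst (λ u → Δ₀ (∀' (x₀ ≺ u ⇒ subst (lift σ) φ))) (sym (substₜ-lift-shiftₜ σ t))
    (ball (substₜ σ t) (Δ₀-subst (lift σ) p))
Δ₀-subst σ (bex {φ} t p) =
  ≡-subst (λ u → Δ₀ (∃' (x₀ ≺ u ∧' subst (lift σ) φ))) (sym (substₜ-lift-shiftₜ σ t))
    (bex (substₜ σ t) (Δ₀-subst (lift σ) p))

Σ₁-subst : (σ : Subst n m) {φ : Formula n} → Σ₁ φ → Σ₁ (subst σ φ)
Σ₁-subst σ (base p) = base (Δ₀-subst σ p)
Σ₁-subst σ (ex p)   = ex (Σ₁-subst (lift σ) p)

ball-⊨ : {φ : Formula (suc n)} (ρ : Vec ℕ n) (t : Term n) →
         (∀ {a} → a < evalₜ ρ t → a ∷ ρ ⊨ φ) → ρ ⊨ ∀' (x₀ ≺ shiftₜ t ⇒ φ)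
ball-⊨ ρ t h a a< = h (≡-subst (a <_) (evalₜ-shiftₜ a ρ t) a<)

bex-⊨ : {φ : Formula (suc n)} (ρ : Vec ℕ n) (t : Term n) {a : ℕ} →
        a < evalₜ ρ t → a ∷ ρ ⊨ φ → ρ ⊨ ∃' (x₀ ≺ shiftₜ t ∧' φ)
bex-⊨ ρ t {a} a< p none = none a λ f → f (≡-subst (a <_) (sym (evalₜ-shiftₜ a ρ t)) a<) p

ball-⊨⁻ : {φ : Formula (suc n)} (ρ : Vec ℕ n) (t : Term n) →
          ρ ⊨ ∀' (x₀ ≺ shiftₜ t ⇒ φ) → ∀ {a} → a < evalₜ ρ t → a ∷ ρ ⊨ φ
ball-⊨⁻ ρ t h {a} a< = h a (≡-subst (a <_) (sym (evalₜ-shiftₜ a ρ t)) a<)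

-- `∃'` is a classical abbreviation, so its truth does not hand over a witness. Witnesses are
-- instead found by search below the bound, and this lemma excludes a failing search.
¬bex-⊨ : {φ : Formula (suc n)} (ρ : Vec ℕ n) (t : Term n) →
         (∀ {a} → a < evalₜ ρ t → ¬ (a ∷ ρ ⊨ φ)) → ¬ (ρ ⊨ ∃' (x₀ ≺ shiftₜ t ∧' φ))
¬bex-⊨ ρ t none f = f λ a g → g λ a< p → none (≡-subst (a <_) (evalₜ-shiftₜ a ρ t) a<) p

-- Bounded quantifiers are finite searches.
Δ₀-dec : {φ : Formula n} → Δ₀ φ → ∀ ρ → Dec (ρ ⊨ φ)
Δ₀-dec (eq s t)   ρ = evalₜ ρ s ≟ evalₜ ρ t
Δ₀-dec (lt s t)   ρ = evalₜ ρ s <? evalₜ ρ t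
Δ₀-dec bot        ρ = no λ ()
Δ₀-dec (imp p q)  ρ = Δ₀-dec p ρ →-dec Δ₀-dec q ρ
Δ₀-dec (ball t p) ρ = map′ (ball-⊨ ρ t) (ball-⊨⁻ ρ t)
  (allUpTo? (λ a → Δ₀-dec p (a ∷ ρ)) (evalₜ ρ t))
Δ₀-dec (bex t p)  ρ with anyUpTo? (λ a → Δ₀-dec p (a ∷ ρ)) (evalₜ ρ t)
... | yes (a , a< , q) = yes (bex-⊨ ρ t a< q)
... | no  none         = no (¬bex-⊨ ρ t λ {a} a< q → none (a , a< , q))

subst-⋁ : (σ : Subst n m) {A : Set} (f : A → Formula n) → ∀ xs →
          subst σ (⋁ (map f xs)) ≡ ⋁ (map (subst σ ∘ f) xs)
subst-⋁ σ f []       = refl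
subst-⋁ σ f (x ∷ xs) = cong (subst σ (f x) ∨'_) (subst-⋁ σ f xs)

-- Σ₁-completeness

module _ {T : Theory ℓ} where

  private variable
    Γ : List (Formula n)
    φ ψ χ : Formula n

  hyp₀ : T ∣ φ ∷ Γ ⊢ φ
  hyp₀ = hyp (here refl)

  weaken₁ : T ∣ Γ ⊢ φ → T ∣ ψ ∷ Γ ⊢ φ
  weaken₁ = weaken there

  ≡-⊢ : φ ≡ ψ → T ∣ Γ ⊢ φ → T ∣ Γ ⊢ ψ
  ≡-⊢ refl d = d

  ⊥-E : T ∣ Γ ⊢ ⊥' → T ∣ Γ ⊢ φ
  ⊥-E d = raa (weaken₁ d)

  ∧-I : T ∣ Γ ⊢ φ → T ∣ Γ ⊢ ψ → T ∣ Γ ⊢ φ ∧' ψ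
  ∧-I d e = ⇒I (⇒E (⇒E hyp₀ (weaken₁ d)) (weaken₁ e))

  ∧-E₁ : T ∣ Γ ⊢ φ ∧' ψ → T ∣ Γ ⊢ φ
  ∧-E₁ d = raa (⇒E (weaken₁ d) (⇒I (⊥-E (⇒E (weaken₁ hyp₀) hyp₀))))

  ∧-E₂ : T ∣ Γ ⊢ φ ∧' ψ → T ∣ Γ ⊢ ψ
  ∧-E₂ d = raa (⇒E (weaken₁ d) (⇒I (weaken₁ hyp₀)))

  ∨-I₁ : T ∣ Γ ⊢ φ → T ∣ Γ ⊢ φ ∨' ψ
  ∨-I₁ d = ⇒I (⊥-E (⇒E hyp₀ (weaken₁ d)))

  ∨-I₂ : T ∣ Γ ⊢ ψ → T ∣ Γ ⊢ φ ∨' ψ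
  ∨-I₂ d = ⇒I (weaken₁ d)

  -- Under the assumption `¬' χ` the first case refutes `φ`; the disjunction, an implication from
  -- `¬' φ`, then yields `ψ`, and the second case gives `χ`.
  ∨-E : T ∣ Γ ⊢ φ ∨' ψ → T ∣ φ ∷ Γ ⊢ χ → T ∣ ψ ∷ Γ ⊢ χ → T ∣ Γ ⊢ χ
  ∨-E d e f = raa (⇒E hyp₀ (⇒E (weaken₁ (⇒I f))
    (⇒E (weaken₁ d) (⇒I (⇒E (weaken₁ hyp₀) (⇒E (weaken₁ (weaken₁ (⇒I e))) hyp₀))))))

  ⋁-I : ∀ {φs} → φ ∈ˡ φs → T ∣ Γ ⊢ φ → T ∣ Γ ⊢ ⋁ φs
  ⋁-I (here refl) d = ∨-I₁ d
  ⋁-I (there p)   d = ∨-I₂ (⋁-I p d)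

  ⋁-E : ∀ φs → T ∣ Γ ⊢ ⋁ φs → (∀ {φ} → φ ∈ˡ φs → T ∣ φ ∷ Γ ⊢ χ) → T ∣ Γ ⊢ χ
  ⋁-E []       d e = ⊥-E d
  ⋁-E (φ ∷ φs) d e = ∨-E d (e (here refl))
    (⋁-E φs hyp₀ λ p → weaken (∷⁺ʳ _ there) (e (there p)))

  shift-⊢ : T ∣ Γ ⊢ φ → T ∣ map shift Γ ⊢ shift φ
  shift-⊢ = subst-⊢ _

module Completeness {T : Theory ℓ} (R₀⊆T : StrongerThan T R₀) where

  private variable
    Γ : List (Formula n)
    φ ψ χ : Formula n
    s t u v : Term n

  R₀-axiom : {φ : Formula n} → R₀ (∀* φ) → (σ : Subst n m) {Γ : List (Formula m)} →
             T ∣ Γ ⊢ subst σ φ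
  R₀-axiom r = ∀*-elim (R₀⊆T r)

  ⊢-refl : T ∣ Γ ⊢ t ≐ t
  ⊢-refl {t = t} = R₀-axiom (equality ≐-refl) (lookup (t ∷ []))

  ⊢-sym : T ∣ Γ ⊢ s ≐ t → T ∣ Γ ⊢ t ≐ s
  ⊢-sym {s = s} {t} = ⇒E (R₀-axiom (equality ≐-sym) (lookup (s ∷ t ∷ [])))

  ⊢-trans : T ∣ Γ ⊢ s ≐ t → T ∣ Γ ⊢ t ≐ u → T ∣ Γ ⊢ s ≐ u
  ⊢-trans {s = s} {t} {u} d = ⇒E (⇒E (R₀-axiom (equality ≐-trans) (lookup (s ∷ t ∷ u ∷ []))) d)

  ⊢-⊕-cong : T ∣ Γ ⊢ s ≐ t → T ∣ Γ ⊢ u ≐ v → T ∣ Γ ⊢ s ⊕ u ≐ t ⊕ v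
  ⊢-⊕-cong {s = s} {t} {u} {v} d =
    ⇒E (⇒E (R₀-axiom (equality ⊕-cong) (lookup (s ∷ t ∷ u ∷ v ∷ []))) d)

  ⊢-⊗-cong : T ∣ Γ ⊢ s ≐ t → T ∣ Γ ⊢ u ≐ v → T ∣ Γ ⊢ s ⊗ u ≐ t ⊗ v
  ⊢-⊗-cong {s = s} {t} {u} {v} d =
    ⇒E (⇒E (R₀-axiom (equality ⊗-cong) (lookup (s ∷ t ∷ u ∷ v ∷ []))) d)

  ⊢-≺-cong : T ∣ Γ ⊢ s ≐ t → T ∣ Γ ⊢ u ≐ v → T ∣ Γ ⊢ s ≺ u → T ∣ Γ ⊢ t ≺ v
  ⊢-≺-cong {s = s} {t} {u} {v} d e =
    ⇒E (⇒E (⇒E (R₀-axiom (equality ≺-cong) (lookup (s ∷ t ∷ u ∷ v ∷ []))) d) e)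

  ⊢-⊕-numeral : ∀ a b → T ∣ Γ ⊢ numeral a ⊕ numeral b ≐ numeral (a + b)
  ⊢-⊕-numeral a b = ≡-⊢
    (cong₂ _≐_ (cong₂ _⊕_ (substₜ-numeral _ a) (substₜ-numeral _ b)) (substₜ-numeral _ (a + b)))
    (R₀-axiom {n = 0} (⊕-num a b) λ ())

  ⊢-⊗-numeral : ∀ a b → T ∣ Γ ⊢ numeral a ⊗ numeral b ≐ numeral (a * b)
  ⊢-⊗-numeral a b = ≡-⊢
    (cong₂ _≐_ (cong₂ _⊗_ (substₜ-numeral _ a) (substₜ-numeral _ b)) (substₜ-numeral _ (a * b)))
    (R₀-axiom {n = 0} (⊗-num a b) λ ())

  ⊢-≢-numeral : ∀ {a b} → a ≢ b → T ∣ Γ ⊢ ¬' (numeral a ≐ numeral b)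
  ⊢-≢-numeral {a = a} {b} a≢b = ≡-⊢
    (cong₂ (λ s t → ¬' (s ≐ t)) (substₜ-numeral _ a) (substₜ-numeral _ b))
    (R₀-axiom {n = 0} (≐-num a b a≢b) λ ())

  ⊢-≺-numeral : (t : Term n) → ∀ b {Γ : List (Formula n)} →
                T ∣ Γ ⊢ t ≺ numeral b ⇔' ⋁ (map (λ i → t ≐ numeral i) (upTo b))
  ⊢-≺-numeral t b = ≡-⊢
    (cong₂ (λ u φ → t ≺ u ⇔' φ) (substₜ-numeral _ b)
      (trans (subst-⋁ _ _ (upTo b))
        (cong ⋁ (map-cong (λ i → cong (t ≐_) (substₜ-numeral _ i)) (upTo b)))))
    (R₀-axiom {n = 1} (≺-num b) λ _ → t)

  ≺-numeral-I : ∀ {a b} → a < b → T ∣ Γ ⊢ t ≐ numeral a → T ∣ Γ ⊢ t ≺ numeral b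
  ≺-numeral-I {b = b} a<b d =
    ⇒E (∧-E₂ (⊢-≺-numeral _ b)) (⋁-I (∈-map⁺ _ (∈-upTo⁺ a<b)) d)

  ≺-numeral-E : ∀ {b} → T ∣ Γ ⊢ t ≺ numeral b →
                (∀ {a} → a < b → T ∣ (t ≐ numeral a) ∷ Γ ⊢ χ) → T ∣ Γ ⊢ χ
  ≺-numeral-E {Γ = Γ} {t = t} {χ = χ} {b} d e = ⋁-E _ (⇒E (∧-E₁ (⊢-≺-numeral _ b)) d) case
    where
    case : ∀ {φ} → φ ∈ˡ map (λ i → t ≐ numeral i) (upTo b) → T ∣ φ ∷ Γ ⊢ χ
    case p with ∈-map⁻ _ p
    ... | _ , q , refl = e (∈-upTo⁻ q)

  -- Values are attached to variables by hypotheses instead of substituting numerals into formulas.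
  -- Equals are then replaced only inside terms and atoms, where the equality axioms apply directly.
  Env : List (Formula n) → Vec ℕ n → Set _
  Env Γ ρ = ∀ i → T ∣ Γ ⊢ var i ≐ numeral (lookup ρ i)

  Env-∷ : {Γ : List (Formula n)} {ρ : Vec ℕ n} → Env Γ ρ →
          ∀ a → Env ((x₀ ≐ numeral a) ∷ map shift Γ) (a ∷ ρ)
  Env-∷ env a zero    = hyp₀
  Env-∷ {ρ = ρ} env a (suc i) = weaken₁ (≡-⊢
    (cong (var (suc i) ≐_) (substₜ-numeral _ (lookup ρ i))) (shift-⊢ (env i)))

  ⊢-evalₜ : {ρ : Vec ℕ n} → Env Γ ρ → ∀ t → T ∣ Γ ⊢ t ≐ numeral (evalₜ ρ t)
  ⊢-evalₜ env (var i) = env i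
  ⊢-evalₜ env 𝟎       = ⊢-refl
  ⊢-evalₜ env 𝟏       = ⊢-refl
  ⊢-evalₜ env (s ⊕ t) = ⊢-trans (⊢-⊕-cong (⊢-evalₜ env s) (⊢-evalₜ env t)) (⊢-⊕-numeral _ _)
  ⊢-evalₜ env (s ⊗ t) = ⊢-trans (⊢-⊗-cong (⊢-evalₜ env s) (⊢-evalₜ env t)) (⊢-⊗-numeral _ _)

  -- The bound equals a numeral, so a variable below it equals one of finitely many numerals. This
  -- serves both to prove a bounded ∀ and to refute a bounded ∃.
  under : {Γ : List (Formula n)} {t : Term n} {φ : Formula (suc n)} {b : ℕ} →
          T ∣ Γ ⊢ t ≐ numeral b →
          (∀ {a} → a < b → T ∣ (x₀ ≐ numeral a) ∷ map shift Γ ⊢ φ) →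
          T ∣ map shift Γ ⊢ x₀ ≺ shiftₜ t ⇒ φ
  under {b = b} d e = ⇒I (≺-numeral-E
    (⊢-≺-cong ⊢-refl
      (weaken₁ (≡-⊢ (cong (_ ≐_) (substₜ-numeral _ b)) (shift-⊢ d))) hyp₀)
    λ a<b → weaken (∷⁺ʳ _ there) (e a<b))

  -- Instantiation turns the hypothesis on `x₀` into an instance of reflexivity, which discharges
  -- it.
  at : {Γ : List (Formula n)} {φ : Formula (suc n)} → ∀ a →
       T ∣ (x₀ ≐ numeral a) ∷ map shift Γ ⊢ φ → T ∣ Γ ⊢ φ [ numeral a ]
  at {Γ = Γ} {φ} a d = ⇒E (⇒I (≡-subst (λ Δ → T ∣ Δ ⊢ φ [ numeral a ]) unshift (subst-⊢ (inst (numeral a)) d)))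
    (≡-⊢ (cong (numeral a ≐_) (sym (substₜ-numeral _ a))) ⊢-refl)
    where
    unshift : map (subst (inst (numeral a))) ((x₀ ≐ numeral a) ∷ map shift Γ)
            ≡ (numeral a ≐ substₜ _ (numeral a)) ∷ Γ
    unshift = cong (_ ∷_) (trans (sym (map-∘ Γ))
      (trans (map-cong (subst-inst-shift (numeral a)) Γ) (map-id Γ)))

  ⊢-≺-at : {Γ : List (Formula n)} {t : Term n} {a b : ℕ} → a < b →
           T ∣ Γ ⊢ t ≐ numeral b →
           T ∣ Γ ⊢ numeral a ≺ substₜ (inst (numeral a)) (shiftₜ t)
  ⊢-≺-at {t = t} {a} a<b d = ≡-subst (λ u → T ∣ _ ⊢ numeral a ≺ u)
    (sym (substₜ-inst-shiftₜ (numeral a) t))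
    (⊢-≺-cong ⊢-refl (⊢-sym d) (≺-numeral-I a<b ⊢-refl))

  -- Simultaneous induction: proving an implication with a false premise requires refuting the
  -- premise.
  Δ₀-proves  : Δ₀ φ → ∀ {ρ} → Env Γ ρ → ρ ⊨ φ → T ∣ Γ ⊢ φ
  Δ₀-refutes : Δ₀ φ → ∀ {ρ} → Env Γ ρ → ¬ (ρ ⊨ φ) → T ∣ Γ ⊢ ¬' φ
  Δ₀-proves (eq s t) env h =
    ⊢-trans (⊢-evalₜ env s)
      (⊢-sym (≡-subst (λ a → T ∣ _ ⊢ t ≐ numeral a) (sym h) (⊢-evalₜ env t)))
  Δ₀-proves (lt s t) env h =
    ⊢-≺-cong ⊢-refl (⊢-sym (⊢-evalₜ env t)) (≺-numeral-I h (⊢-evalₜ env s))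
  Δ₀-proves (imp p q) {ρ} env h with Δ₀-dec p ρ
  ... | yes a = ⇒I (weaken₁ (Δ₀-proves q env (h a)))
  ... | no ¬a = ⇒I (⊥-E (⇒E (weaken₁ (Δ₀-refutes p env ¬a)) hyp₀))
  Δ₀-proves (ball t p) {ρ} env h = ∀I (under (⊢-evalₜ env t)
    λ a< → Δ₀-proves p (Env-∷ env _) (ball-⊨⁻ ρ t h a<))
  Δ₀-proves (bex {φ} t p) {ρ} env h with anyUpTo? (λ a → Δ₀-dec p (a ∷ ρ)) (evalₜ ρ t)
  ... | yes (a , a< , q) = ⇒I (⇒E (∀E hyp₀ (numeral a))
          (weaken₁ (∧-I (⊢-≺-at a< (⊢-evalₜ env t)) (at a (Δ₀-proves p (Env-∷ env a) q)))))
  ... | no none = ⊥-elim (¬bex-⊨ {φ = φ} ρ t (λ {a} a< q → none (a , a< , q)) h)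
  Δ₀-refutes (eq s t) env h = ⇒I (⇒E (⊢-≢-numeral h)
    (⊢-trans (⊢-sym (weaken₁ (⊢-evalₜ env s)))
      (⊢-trans hyp₀ (weaken₁ (⊢-evalₜ env t)))))
  Δ₀-refutes (lt s t) env h = ⇒I (≺-numeral-E
    (⊢-≺-cong (weaken₁ (⊢-evalₜ env s)) (weaken₁ (⊢-evalₜ env t)) hyp₀)
    λ a< → ⇒E (⊢-≢-numeral λ { refl → h a< }) hyp₀)
  Δ₀-refutes bot env h = ⇒I hyp₀
  Δ₀-refutes (imp p q) {ρ} env h with Δ₀-dec p ρ
  ... | no ¬a = ⊥-elim (h (⊥-elim ∘ ¬a))
  ... | yes a = ⇒I (⇒E (weaken₁ (Δ₀-refutes q env λ b → h λ _ → b))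
          (⇒E hyp₀ (weaken₁ (Δ₀-proves p env a))))
  Δ₀-refutes (ball {φ} t p) {ρ} env h with anyUpTo? (λ a → ¬? (Δ₀-dec p (a ∷ ρ))) (evalₜ ρ t)
  ... | yes (a , a< , ¬q) = ⇒I (⇒E (weaken₁ (at a (Δ₀-refutes p (Env-∷ env a) ¬q)))
          (⇒E (∀E hyp₀ (numeral a)) (weaken₁ (⊢-≺-at a< (⊢-evalₜ env t)))))
  ... | no none = ⊥-elim (h (ball-⊨ {φ = φ} ρ t λ {a} a< →
          decidable-stable (Δ₀-dec p (a ∷ ρ)) λ ¬q → none (a , a< , ¬q)))
  -- The bounded ∃ unfolds to ¬∀x¬¬(x < t ⇒ ¬φ), so its refutation rests on the implication that
  -- `under` supplies.
  Δ₀-refutes (bex t p) {ρ} env h = ⇒I (⇒E hyp₀ (weaken₁ (∀I (⇒I (⇒E hyp₀ (weaken₁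
    (under (⊢-evalₜ env t)
      λ a< → Δ₀-refutes p (Env-∷ env _) λ q → h (bex-⊨ ρ t a< q))))))))

  -- A true existential formula has a witness only up to double negation, hence the form of the
  -- conclusion.
  Σ₁-complete : Σ₁ φ → ∀ {ρ} → Env Γ ρ → ρ ⊨ φ → ¬ ¬ (T ∣ Γ ⊢ φ)
  Σ₁-complete (base p) env h ¬d = ¬d (Δ₀-proves p env h)
  Σ₁-complete (ex p)   env h ¬d = h λ a q → Σ₁-complete p (Env-∷ env a) q λ d →
    ¬d (⇒I (⇒E (∀E hyp₀ (numeral a)) (weaken₁ (at a d))))

-- Pairs and tuples of numbers

-- Pairs with sum s have codes from s² to s² + s, below (s + 1)², so larger sums have larger codes.
⟪⟫-< : ∀ a b c d → a + b < c + d → ⟪ a , b ⟫ < ⟪ c , d ⟫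
⟪⟫-< a b c d s<t = begin-strict
  s * s + a               ≤⟨ +-monoʳ-≤ (s * s) (m≤m+n a b) ⟩
  s * s + s               <⟨ m<m+n (s * s + s) (s≤s {n = s} z≤n) ⟩
  s * s + s + suc s       ≡⟨ square s ⟩
  suc s * suc s           ≤⟨ *-mono-≤ s<t s<t ⟩
  (c + d) * (c + d)       ≤⟨ m≤m+n _ c ⟩
  (c + d) * (c + d) + c   ∎
  where
  open ≤-Reasoning
  s = a + b
  square : ∀ s → s * s + s + (1 + s) ≡ (1 + s) * (1 + s)
  square = solve-∀

⟪⟫-injective : ∀ a b c d → ⟪ a , b ⟫ ≡ ⟪ c , d ⟫ → a ≡ c × b ≡ d
⟪⟫-injective a b c d e with <-cmp (a + b) (c + d)
... | tri< s<t _ _ = ⊥-elim (<-irrefl e (⟪⟫-< a b c d s<t))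
... | tri> _ _ t<s = ⊥-elim (<-irrefl (sym e) (⟪⟫-< c d a b t<s))
... | tri≈ _ s≡t _ = a≡c , +-cancelˡ-≡ a b d (trans s≡t (cong (_+ d) (sym a≡c)))
  where
  a≡c : a ≡ c
  a≡c = +-cancelˡ-≡ ((c + d) * (c + d)) a c (trans (cong (λ s → s * s + a) (sym s≡t)) e)

tuple : ∀ {k} → Vec ℕ k → ℕ
tuple []      = 0
tuple (a ∷ v) = ⟪ a , tuple v ⟫

tuple-injective : ∀ {k} (v w : Vec ℕ k) → tuple v ≡ tuple w → v ≡ w
tuple-injective []      []      e = refl
tuple-injective (a ∷ v) (b ∷ w) e with refl , f ← ⟪⟫-injective a (tuple v) b (tuple w) e =
  cong (a ∷_) (tuple-injective v w f)

-- Finite sets of numbers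

-- The numbers divisor m u for u < B are pairwise coprime when m = B !, so that
-- a set of numbers below B can be coded by the product of their divisors.
divisor : ℕ → ℕ → ℕ
divisor m u = 1 + (1 + u) * m

∣! : ∀ {a b} → suc a ≤ b → suc a ∣ℕ b !
∣! {a} a<b = ∣-trans (m∣m*n (a !)) (m≤n⇒m!∣n! a<b)

-- With v = u + 1 + e, a common divisor d divides (1 + v)(1 + (1 + u)m) - (1 + u)(1 + (1 + v)m) = 1
-- + e. Since 1 + e ≤ B, d divides m = B !, and hence 1.
divisor-coprime-< : ∀ {B u v} → u < v → v < B → Coprime (divisor (B !) u) (divisor (B !) v)
divisor-coprime-< {B} {u} {v} u<v v<B {d} (d∣u , d∣v) with m≤n⇒∃[o]m+o≡n u<v
... | e , refl = ∣1⇒≡1 (∣m+n∣m⇒∣n (≡-subst (d ∣ℕ_) (+-comm 1 _) d∣u) (∣n⇒∣m*n (1 + u) d∣m))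
  where
  combination : ∀ u e m → (1 + (1 + u + e)) * (1 + (1 + u) * m)
                        ≡ (1 + u) * (1 + (1 + (1 + u + e)) * m) + (1 + e)
  combination = solve-∀
  d∣difference : d ∣ℕ suc e
  d∣difference = ∣m+n∣m⇒∣n
    (≡-subst (d ∣ℕ_) (combination u e (B !)) (∣n⇒∣m*n (1 + v) d∣u)) (∣n⇒∣m*n (1 + u) d∣v)
  d∣m : d ∣ℕ B !
  d∣m = ∣-trans d∣difference (∣! (≤-trans (s≤s (m≤n+m e u)) (<⇒≤ v<B)))

divisor-coprime : ∀ {B u v} → u ≢ v → u < B → v < B →
                  Coprime (divisor (B !) u) (divisor (B !) v)
divisor-coprime {u = u} {v} u≢v u<B v<B with <-cmp u v
... | tri< s<t _ _ = divisor-coprime-< s<t v<B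
... | tri≈ _ s≡t _ = ⊥-elim (u≢v s≡t)
... | tri> _ _ t<s = coprime-sym (divisor-coprime-< t<s u<B)

setCode : ℕ → List ℕ → ℕ
setCode m us = product (map (divisor m) us)

∈⇒∣setCode : ∀ m {u us} → u ∈ˡ us → divisor m u ∣ℕ setCode m us
∈⇒∣setCode m u∈us = ∈⇒∣product (∈-map⁺ (divisor m) u∈us)

-- The divisor of `u` is coprime to that of every other element, so such factors can be cancelled
-- from the product one by one.
∣setCode⇒∈ : ∀ {B u us} → All (_< B) us → u < B →
             divisor (B !) u ∣ℕ setCode (B !) us → u ∈ˡ us
∣setCode⇒∈ {B} {u} [] u<B d =
  ⊥-elim (positive (suc-injective (∣1⇒≡1 d)))
  where
  -- The empty product is 1, whereas every divisor exceeds 1 because `B !` is nonzero.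
  positive : (1 + u) * B ! ≢ 0
  positive = ≢-nonZero⁻¹ _ ⦃ m*n≢0 (1 + u) (B !) ⦃ _ ⦄ ⦃ B !≢0 ⦄ ⦄
∣setCode⇒∈ {B} {u} {v ∷ us} (v<B ∷ us<B) u<B d with u ≟ v
... | yes refl = here refl
... | no  u≢v  = there (∣setCode⇒∈ us<B u<B (coprime-divisor (divisor-coprime u≢v u<B v<B) d))

-- Δ₀-definable predicates

Denotes : (E → Vec ℕ n) → Term n → (E → ℕ) → Set
Denotes env t f = ∀ e → evalₜ (env e) t ≡ f e

-- A formula in n variables defines a predicate on any type E of environments,
-- so that the predicate can be stated without reference to de Bruijn indices.
record Definable {E : Set} {n : ℕ} (env : E → Vec ℕ n) (P : E → Set) : Set where
  field
    formula : Formula n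
    isΔ₀    : Δ₀ formula
    to      : ∀ e → env e ⊨ formula → P e
    from    : ∀ e → P e → env e ⊨ formula

  -- This recovers constructive pairs, alternatives and witnesses from the classical abbreviations
  -- `∧'`, `∨'` and `∃'`.
  dec : ∀ e → Dec (env e ⊨ formula)
  dec e = Δ₀-dec isΔ₀ (env e)

open Definable

mapᴰ : {P Q : E → Set} → (∀ e → P e → Q e) → (∀ e → Q e → P e) →
       Definable env P → Definable env Q
mapᴰ f g d = record
  { formula = d .formula
  ; isΔ₀    = d .isΔ₀
  ; to      = λ e → f e ∘ d .to e
  ; from    = λ e → d .from e ∘ g e
  }

reindexᴰ : {E′ : Set} {P : E → Set} (h : E′ → E) →
           Definable env P → Definable (env ∘ h) (P ∘ h)
reindexᴰ h d = record
  { formula = d .formula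
  ; isΔ₀    = d .isΔ₀
  ; to      = d .to ∘ h
  ; from    = d .from ∘ h
  }

≡ᴰ : ∀ {s t} {f g : E → ℕ} → Denotes env s f → Denotes env t g →
     Definable env (λ e → f e ≡ g e)
≡ᴰ {s = s} {t} p q = record
  { formula = s ≐ t
  ; isΔ₀    = eq s t
  ; to      = λ e → subst₂ _≡_ (p e) (q e)
  ; from    = λ e → subst₂ _≡_ (sym (p e)) (sym (q e))
  }

<ᴰ : ∀ {s t} {f g : E → ℕ} → Denotes env s f → Denotes env t g →
     Definable env (λ e → f e < g e)
<ᴰ {s = s} {t} p q = record
  { formula = s ≺ t
  ; isΔ₀    = lt s t
  ; to      = λ e → subst₂ _<_ (p e) (q e)
  ; from    = λ e → subst₂ _<_ (sym (p e)) (sym (q e))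
  }

⊥ᴰ : Definable env (λ _ → ⊥)
⊥ᴰ = record { formula = ⊥' ; isΔ₀ = bot ; to = λ _ () ; from = λ _ () }

→ᴰ : {P Q : E → Set} → Definable env P → Definable env Q →
     Definable env (λ e → P e → Q e)
→ᴰ p q = record
  { formula = p .formula ⇒ q .formula
  ; isΔ₀    = imp (p .isΔ₀) (q .isΔ₀)
  ; to      = λ e h → q .to e ∘ h ∘ p .from e
  ; from    = λ e h → q .from e ∘ h ∘ p .to e
  }

⊤ᴰ : Definable env (λ _ → ⊤)
⊤ᴰ = mapᴰ (λ _ _ → tt) (λ _ _ → id) (→ᴰ ⊥ᴰ ⊥ᴰ)

×ᴰ : {P Q : E → Set} → Definable env P → Definable env Q →
     Definable env (λ e → P e × Q e)
×ᴰ p q = record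
  { formula = p .formula ∧' q .formula
  ; isΔ₀    = imp (imp (p .isΔ₀) (imp (q .isΔ₀) bot)) bot
  ; to      = conjuncts
  ; from    = λ e (a , b) f → f (p .from e a) (q .from e b)
  }
  where
  conjuncts : ∀ e → _ → _
  conjuncts e h with dec p e | dec q e
  ... | yes a | yes b = p .to e a , q .to e b
  ... | no ¬a | _     = ⊥-elim (h λ a → ⊥-elim (¬a a))
  ... | yes _ | no ¬b = ⊥-elim (h λ _ → ¬b)

⊎ᴰ : {P Q : E → Set} → Definable env P → Definable env Q →
     Definable env (λ e → P e ⊎ Q e)
⊎ᴰ p q = record
  { formula = p .formula ∨' q .formula
  ; isΔ₀    = imp (imp (p .isΔ₀) bot) (q .isΔ₀)
  ; to      = disjunct
  ; from    = λ { e (inj₁ a) ¬a → ⊥-elim (¬a (p .from e a)) ; e (inj₂ b) _ → q .from e b }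
  }
  where
  disjunct : ∀ e → _ → _
  disjunct e h with dec p e
  ... | yes a = inj₁ (p .to e a)
  ... | no ¬a = inj₂ (q .to e (h ¬a))

∀<ᴰ : ∀ {t f} {P : E → ℕ → Set} → Denotes env t f →
      Definable (λ (e , a) → a ∷ env e) (uncurry P) →
      Definable env (λ e → ∀ a → a < f e → P e a)
∀<ᴰ {env = env} {t} b d = record
  { formula = ∀' (x₀ ≺ shiftₜ t ⇒ d .formula)
  ; isΔ₀    = ball t (d .isΔ₀)
  ; to      = λ e h a a< → d .to (e , a)
                (ball-⊨⁻ {φ = d .formula} (env e) t h (≡-subst (a <_) (sym (b e)) a<))
  ; from    = λ e h → ball-⊨ {φ = d .formula} (env e) t λ {a} a< →
                d .from (e , a) (h a (≡-subst (a <_) (b e) a<))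
  }

∃<ᴰ : ∀ {t f} {P : E → ℕ → Set} → Denotes env t f →
      Definable (λ (e , a) → a ∷ env e) (uncurry P) →
      Definable env (λ e → ∃ λ a → a < f e × P e a)
∃<ᴰ {env = env} {t} b d = record
  { formula = ∃' (x₀ ≺ shiftₜ t ∧' d .formula)
  ; isΔ₀    = bex t (d .isΔ₀)
  ; to      = witness
  ; from    = λ e (a , a< , p) → bex-⊨ {φ = d .formula} (env e) t
                (≡-subst (a <_) (sym (b e)) a<) (d .from (e , a) p)
  }
  where
  witness : ∀ e → _ → _
  witness e h with anyUpTo? (λ a → dec d (e , a)) (evalₜ (env e) t)
  ... | yes (a , a< , p) = a , ≡-subst (a <_) (b e) a< , d .to (e , a) p
  ... | no none = ⊥-elim (¬bex-⊨ {φ = d .formula} (env e) t (λ {a} a< q → none (a , a< , q)) h)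

Allᴰ : {A : Set} {P : A → E → Set} → (∀ x → Definable env (P x)) →
       ∀ xs → Definable env (λ e → All (λ x → P x e) xs)
Allᴰ d []       = mapᴰ (λ _ _ → []) (λ _ _ → tt) ⊤ᴰ
Allᴰ d (x ∷ xs) =
  mapᴰ (λ _ (p , ps) → p ∷ ps) (λ { _ (p ∷ ps) → p , ps }) (×ᴰ (d x) (Allᴰ d xs))

∃Finᴰ : ∀ k {P : Fin k → E → Set} → (∀ i → Definable env (P i)) →
        Definable env (λ e → ∃ λ i → P i e)
∃Finᴰ zero    d = mapᴰ (λ _ ()) (λ _ ()) ⊥ᴰ
∃Finᴰ (suc k) d = mapᴰ
  (λ { _ (inj₁ p) → zero , p ; _ (inj₂ (i , p)) → suc i , p })
  (λ { _ (zero , p) → inj₁ p ; _ (suc i , p) → inj₂ (i , p) })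
  (⊎ᴰ (d zero) (∃Finᴰ k (d ∘ suc)))

-- A block of `k` quantified variables is placed before the environment: `raiseₜ` moves terms of the
-- environment past it, and `injectₜ` reads terms over the block alone.
raiseₜ : ∀ k → Term n → Term (k + n)
raiseₜ k = substₜ λ i → var (k ↑ʳ i)

injectₜ : ∀ n → Term k → Term (k + n)
injectₜ n = substₜ λ i → var (i ↑ˡ n)

evalₜ-raiseₜ : (v : Vec ℕ k) (ρ : Vec ℕ n) → ∀ t → evalₜ (v ++ ρ) (raiseₜ k t) ≡ evalₜ ρ t
evalₜ-raiseₜ v ρ = evalₜ-substₜ λ i → sym (lookup-++ʳ v ρ i)

evalₜ-injectₜ : (v : Vec ℕ k) (ρ : Vec ℕ n) → ∀ t → evalₜ (v ++ ρ) (injectₜ n t) ≡ evalₜ v t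
evalₜ-injectₜ v ρ = evalₜ-substₜ λ i → sym (lookup-++ˡ v ρ i)

∃Vecᴰ : ∀ k {t f} {P : E → Vec ℕ k → Set} → Denotes env t f →
        Definable (λ (e , v) → v ++ env e) (uncurry P) →
        Definable env (λ e → ∃ λ v → Allᵛ (_< f e) v × P e v)
∃Vecᴰ zero b d = mapᴰ (λ _ p → [] , [] , p) (λ { _ ([] , [] , p) → p }) (reindexᴰ (_, []) d)
∃Vecᴰ {env = env} (suc k) {t} b d = mapᴰ
  (λ { _ (v , v< , a , a< , p) → a ∷ v , a< ∷ v< , p })
  (λ { _ (a ∷ v , a< ∷ v< , p) → v , v< , a , a< , p })
  (∃Vecᴰ k {t} b (∃<ᴰ {t = raiseₜ k t} (λ (e , v) → trans (evalₜ-raiseₜ v (env e) t) (b e))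
    (reindexᴰ (λ ((e , v) , a) → e , a ∷ v) d)))

-- A common bound on the quantifier prefix makes a Σ₁ formula usable inside a Δ₀ one. Unlike truth,
-- it carries actual witnesses.
Bounded : {φ : Formula n} → Σ₁ φ → ℕ → Vec ℕ n → Set
Bounded (base {φ} _) b ρ = ρ ⊨ φ
Bounded (ex s)       b ρ = ∃ λ a → a < b × Bounded s b (a ∷ ρ)

Bounded-mono : {φ : Formula n} (s : Σ₁ φ) → ∀ {b c ρ} → b ≤ c → Bounded s b ρ → Bounded s c ρ
Bounded-mono (base _) b≤c p            = p
Bounded-mono (ex s)   b≤c (a , a< , p) = a , <-≤-trans a< b≤c , Bounded-mono s b≤c p

Bounded⇒⊨ : {φ : Formula n} (s : Σ₁ φ) → ∀ {b ρ} → Bounded s b ρ → ρ ⊨ φ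
Bounded⇒⊨ (base _) p           = p
Bounded⇒⊨ (ex s)   (a , _ , p) = λ none → none a (Bounded⇒⊨ s p)

⊨⇒Bounded : {φ : Formula n} (s : Σ₁ φ) → ∀ {ρ} → ρ ⊨ φ → ¬ ¬ ∃ λ b → Bounded s b ρ
⊨⇒Bounded (base _) p ¬b = ¬b (0 , p)
⊨⇒Bounded (ex s)   p ¬b = p λ a q → ⊨⇒Bounded s q λ (b , r) →
  ¬b (suc a ⊔ b , a , m≤m⊔n (suc a) b , Bounded-mono s (m≤n⊔m (suc a) b) r)

Boundedᴰ : {φ : Formula k} (s : Σ₁ φ) (τ : Subst k n) {f : E → Vec ℕ k} →
           (∀ e i → lookup (f e) i ≡ evalₜ (env e) (τ i)) →
           ∀ {t g} → Denotes env t g → Definable env (λ e → Bounded s (g e) (f e))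
Boundedᴰ (base {φ} p) τ h b = record
  { formula = subst τ φ
  ; isΔ₀    = Δ₀-subst τ p
  ; to      = λ e → ⊨-subst⁻ (h e) φ
  ; from    = λ e → ⊨-subst⁺ (h e) φ
  }
Boundedᴰ {env = env} (ex s) τ h {t} b = ∃<ᴰ {t = t} b
  (Boundedᴰ s (lift τ) (λ (e , a) → lookup-lift (h e) a) {t = shiftₜ t}
    λ (e , a) → trans (evalₜ-shiftₜ a (env e) t) (b e))

-- Terms denoting codes

pairₜ : Term n → Term n → Term n
pairₜ s t = (s ⊕ t) ⊗ (s ⊕ t) ⊕ s

tupleₜ : Vec (Term n) k → Term n
tupleₜ []      = 𝟎
tupleₜ (t ∷ v) = pairₜ t (tupleₜ v)

map-evalₜ : {ρ : Vec ℕ n} {ρ′ : Vec ℕ m} {f : Term m → Term n} →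
            (∀ t → evalₜ ρ (f t) ≡ evalₜ ρ′ t) →
            (ts : Vec (Term m) k) → Vec.map (evalₜ ρ) (Vec.map f ts) ≡ Vec.map (evalₜ ρ′) ts
map-evalₜ h ts = trans (sym (map-∘ᵛ _ _ ts)) (map-congᵛ h ts)

tupleₜ-denotes : {ts : Vec (Term n) k} {f : E → Vec ℕ k} →
                 (∀ e → Vec.map (evalₜ (env e)) ts ≡ f e) →
                 Denotes env (tupleₜ ts) (tuple ∘ f)
tupleₜ-denotes {env = env} {ts = ts} h e = trans (evalₜ-tupleₜ (env e) ts) (cong tuple (h e))
  where
  evalₜ-tupleₜ : ∀ {n k} (ρ : Vec ℕ n) (ts : Vec (Term n) k) →
                 evalₜ ρ (tupleₜ ts) ≡ tuple (Vec.map (evalₜ ρ) ts)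
  evalₜ-tupleₜ ρ []       = refl
  evalₜ-tupleₜ ρ (t ∷ ts) = cong ⟪ evalₜ ρ t ,_⟫ (evalₜ-tupleₜ ρ ts)

-- Horn clauses

-- The `oracles` are numbers required to satisfy a fixed Σ₁ formula; through them the axioms of the
-- theory enter.
record Rule (tags width : ℕ) : Set where
  constructor rule
  field
    vars       : ℕ
    conclusion : Vec (Term vars) width
    premises   : List (Fin tags × Vec (Term vars) width)
    oracles    : List (Term vars)

module Horn {tags width : ℕ} (rules : Fin tags → List (Rule tags width))
            {σ : Formula 1} (Σ₁-σ : Σ₁ σ) where

  open Rule

  instantiate : Vec ℕ k → Vec (Term k) width → Vec ℕ width
  instantiate v = Vec.map (evalₜ v)

  the-rule : ∀ g → Fin (length (rules g)) → Rule tags width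
  the-rule g = List.lookup (rules g)

  data Derivable : Fin tags → Vec ℕ width → Set where
    node : ∀ {g} (i : Fin (length (rules g))) (v : Vec ℕ (vars (the-rule g i))) →
           All (λ (h , p) → Derivable h (instantiate v p)) (premises (the-rule g i)) →
           All (λ o → evalₜ v o ∷ [] ⊨ σ) (oracles (the-rule g i)) →
           Derivable g (instantiate v (conclusion (the-rule g i)))

  module _ (M : Fin tags → Vec ℕ width → Set)
           (sound : ∀ g i v →
                    All (λ (h , p) → M h (instantiate v p)) (premises (the-rule g i)) →
                    All (λ o → evalₜ v o ∷ [] ⊨ σ) (oracles (the-rule g i)) →
                    M g (instantiate v (conclusion (the-rule g i)))) where

    -- `eliminateᴸ` spells out the map over the premises, so that the recursion is visibly
    -- structural.
    eliminate  : ∀ {g y} → Derivable g y → M g y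
    eliminateᴸ : (v : Vec ℕ k) (ps : List (Fin tags × Vec (Term k) width)) →
                 All (λ (h , p) → Derivable h (instantiate v p)) ps →
                 All (λ (h , p) → M h (instantiate v p)) ps
    eliminate (node i v prems orcs) = sound _ i v (eliminateᴸ v _ prems) orcs
    eliminateᴸ v []       []       = []
    eliminateᴸ v (p ∷ ps) (d ∷ ds) = eliminate d ∷ eliminateᴸ v ps ds

  -- A derivation is recorded as the set of its judgements, each with a time
  -- stamp greater than those of the judgements it is inferred from.
  entry : ℕ → Fin tags → Vec ℕ width → ℕ
  entry t g y = tuple (t ∷ toℕ g ∷ y)

  -- The single bound `B` limits the time stamp, the values of the variables and the oracle
  -- witnesses, which keeps the condition Δ₀.
  Fires : ∀ g (r : Rule tags width) (S : ℕ → Set) (B u : ℕ) → Set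
  Fires g r S B u =
    ∃ λ t → t < B × ∃ λ v → Allᵛ (_< B) v ×
      u ≡ entry t g (instantiate v (conclusion r)) ×
      All (λ (h , p) → ∃ λ t′ → t′ < t × S (entry t′ h (instantiate v p))) (premises r) ×
      All (λ o → Bounded Σ₁-σ B (evalₜ v o ∷ [])) (oracles r)

  Justified : (S : ℕ → Set) (B u : ℕ) → Set
  Justified S B u = ∃ λ g → ∃ λ i → Fires g (the-rule g i) S B u

  -- Divisibility of `c`, with a bounded quotient. The number `m` is arbitrary here: backward
  -- closure alone yields derivations, so no formula has to define the factorial.
  Member : (B m c u : ℕ) → Set
  Member B m c u = u < B × ∃ λ q → q < suc c × c ≡ q * divisor m u

  Closed : (B m c : ℕ) → Set
  Closed B m c = ∀ u → u < B → Member B m c u → Justified (Member B m c) B u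

  Recorded : ∀ g → (B m c : ℕ) → Vec ℕ width → Set
  Recorded g B m c y = Closed B m c × ∃ λ t → t < B × Member B m c (entry t g y)

  -- Definability of derivability

  entryₜ : Term n → Fin tags → Vec (Term n) width → Term n
  entryₜ t g ts = tupleₜ (t ∷ numeral (toℕ g) ∷ ts)

  entryₜ-denotes : ∀ {t f} g {ts : Vec (Term n) width} {y : E → Vec ℕ width} → Denotes env t f →
                   (∀ e → Vec.map (evalₜ (env e)) ts ≡ y e) →
                   Denotes env (entryₜ t g ts) (λ e → entry (f e) g (y e))
  entryₜ-denotes {env = env} {t} g {ts} p q = tupleₜ-denotes {env = env} {ts = t ∷ numeral (toℕ g) ∷ ts}
    λ e → cong₂ _∷_ (p e) (cong₂ _∷_ (evalₜ-numeral (env e) (toℕ g)) (q e))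

  Memberᴰ : ∀ {B m c u} {fB fm fc fu : E → ℕ} →
            Denotes env B fB → Denotes env m fm → Denotes env c fc → Denotes env u fu →
            Definable env (λ e → Member (fB e) (fm e) (fc e) (fu e))
  Memberᴰ {env = env} {B} {m} {c} {u} dB dm dc du =
    ×ᴰ (<ᴰ {s = u} {B} du dB) (∃<ᴰ {t = 𝟏 ⊕ c} (λ e → cong suc (dc e))
      (≡ᴰ {s = shiftₜ c} {x₀ ⊗ shiftₜ (𝟏 ⊕ (𝟏 ⊕ u) ⊗ m)}
        (λ (e , q) → trans (evalₜ-shiftₜ q (env e) c) (dc e))
        λ (e , q) → cong (q *_) (trans (evalₜ-shiftₜ q (env e) (𝟏 ⊕ (𝟏 ⊕ u) ⊗ m))
          (cong₂ divisor (dm e) (du e)))))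

  Firesᴰ : ∀ g r → Definable {E = (ℕ × ℕ × ℕ × Vec ℕ n) × ℕ}
             (λ ((B , m , c , ρ) , u) → u ∷ B ∷ m ∷ c ∷ ρ)
             (λ ((B , m , c , ρ) , u) → Fires g r (Member B m c) B u)
  Firesᴰ {n} g (rule k concl prems orcs) =
    -- From the innermost outwards the variables are the `k` variables of the clause, then `t`, `u`,
    -- `B`, `m`, `c` and `ρ`; hence `raiseₜ k` and `5 + n`.
    ∃<ᴰ {t = x₁} (λ _ → refl)
    (∃Vecᴰ k {t = x₂} (λ _ → refl)
    (×ᴰ (≡ᴰ {s = raiseₜ k x₁} {entryₜ (raiseₜ k x₀) g (Vec.map (injectₜ (5 + n)) concl)}
          (λ ((((B , m , c , ρ) , u) , t) , v) → evalₜ-raiseₜ v _ x₁)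
          (entryₜ-denotes {t = raiseₜ k x₀} {proj₂ ∘ proj₁} g {Vec.map (injectₜ (5 + n)) concl} (λ ((((B , m , c , ρ) , u) , t) , v) → evalₜ-raiseₜ v _ x₀)
            λ ((((B , m , c , ρ) , u) , t) , v) → map-evalₜ (evalₜ-injectₜ v (t ∷ u ∷ B ∷ m ∷ c ∷ ρ)) concl))
    (×ᴰ (Allᴰ (λ (h , p) →
          ∃<ᴰ {t = raiseₜ k x₀} (λ ((((B , m , c , ρ) , u) , t) , v) → evalₜ-raiseₜ v _ x₀)
            (Memberᴰ {B = shiftₜ (raiseₜ k x₂)} {shiftₜ (raiseₜ k x₃)} {shiftₜ (raiseₜ k x₄)}
              {entryₜ x₀ h (Vec.map (shiftₜ ∘ injectₜ (5 + n)) p)}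
              (λ (((((B , m , c , ρ) , u) , t) , v) , t′) → shift-raise t′ v _ x₂)
              (λ (((((B , m , c , ρ) , u) , t) , v) , t′) → shift-raise t′ v _ x₃)
              (λ (((((B , m , c , ρ) , u) , t) , v) , t′) → shift-raise t′ v _ x₄)
              (entryₜ-denotes {t = x₀} {proj₂} h {Vec.map (shiftₜ ∘ injectₜ (5 + n)) p} (λ _ → refl)
                λ (((((B , m , c , ρ) , u) , t) , v) , t′) → map-evalₜ (shift-inject t′ v (t ∷ u ∷ B ∷ m ∷ c ∷ ρ)) p))) prems)
        (Allᴰ (λ o → Boundedᴰ Σ₁-σ (lookup (injectₜ (5 + n) o ∷ []))
          (λ { (e , v) zero → sym (evalₜ-injectₜ v _ o) })
          {t = raiseₜ k x₂} λ ((((B , m , c , ρ) , u) , t) , v) → evalₜ-raiseₜ v _ x₂) orcs))))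
    where
    pattern x₄ = var (suc (suc (suc (suc zero))))
    shift-raise : ∀ {n k} a (v : Vec ℕ k) (ρ : Vec ℕ n) t →
                  evalₜ (a ∷ v ++ ρ) (shiftₜ (raiseₜ k t)) ≡ evalₜ ρ t
    shift-raise a v ρ t = trans (evalₜ-shiftₜ a (v ++ ρ) (raiseₜ _ t)) (evalₜ-raiseₜ v ρ t)
    shift-inject : ∀ {n k} a (v : Vec ℕ k) (ρ : Vec ℕ n) t →
                   evalₜ (a ∷ v ++ ρ) (shiftₜ (injectₜ n t)) ≡ evalₜ v t
    shift-inject a v ρ t = trans (evalₜ-shiftₜ a (v ++ ρ) (injectₜ _ t)) (evalₜ-injectₜ v ρ t)

  Closedᴰ : Definable {E = ℕ × ℕ × ℕ × Vec ℕ n} (λ (B , m , c , ρ) → B ∷ m ∷ c ∷ ρ)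
              (λ (B , m , c , ρ) → Closed B m c)
  Closedᴰ = ∀<ᴰ {t = x₀} (λ _ → refl)
    (→ᴰ (Memberᴰ {B = x₁} {x₂} {x₃} {x₀} (λ _ → refl) (λ _ → refl) (λ _ → refl) (λ _ → refl))
      (∃Finᴰ tags λ g → ∃Finᴰ (length (rules g)) λ i → Firesᴰ g (the-rule g i)))

  Recordedᴰ : ∀ g (ts : Vec (Term n) width) →
              Definable {E = ℕ × ℕ × ℕ × Vec ℕ n} (λ (B , m , c , ρ) → B ∷ m ∷ c ∷ ρ)
                (λ (B , m , c , ρ) → Recorded g B m c (Vec.map (evalₜ ρ) ts))
  Recordedᴰ g ts = ×ᴰ Closedᴰ (∃<ᴰ {t = x₀} (λ _ → refl)
    (Memberᴰ {B = x₁} {x₂} {x₃} {entryₜ x₀ g (Vec.map (raiseₜ 4) ts)}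
      (λ _ → refl) (λ _ → refl) (λ _ → refl)
      (entryₜ-denotes {t = x₀} g {Vec.map (raiseₜ 4) ts} (λ _ → refl)
        λ ((B , m , c , ρ) , t) → map-evalₜ (evalₜ-raiseₜ (t ∷ B ∷ m ∷ c ∷ []) ρ) ts)))

  -- Correctness of the Σ₁ definition

  entry-injective : ∀ t g y t′ g′ y′ → entry t g y ≡ entry t′ g′ y′ →
                    t ≡ t′ × g ≡ g′ × y ≡ y′
  entry-injective t g y t′ g′ y′ e
    with tuple-injective (t ∷ toℕ g ∷ y) (t′ ∷ toℕ g′ ∷ y′) e
  ... | f with ∷-injective f
  ... | refl , f′ with ∷-injective f′
  ... | h , refl = refl , toℕ-injective h , refl

  -- Well-founded recursion on the time stamp. By injectivity of `entry`, the clause that justifies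
  -- an entry concludes exactly its judgement, from premises with smaller stamps.
  Recorded⇒Derivable : ∀ {g B m c y} → Recorded g B m c y → Derivable g y
  Recorded⇒Derivable {B = B} {m} {c} (closed , t , _ , p) = derive t (<-wellFounded t) p
    where
    derive : ∀ t → Acc _<_ t → ∀ {g y} → Member B m c (entry t g y) → Derivable g y
    derive t (acc rs) {g} {y} p with closed _ (proj₁ p) p
    ... | g′ , i , t′ , _ , v , _ , e , prems , orcs
      with entry-injective t g y t′ g′ (instantiate v (conclusion (the-rule g′ i))) e
    ... | refl , refl , refl = node i v
      (All.map (λ (t″ , t″<t , q) → derive t″ (rs t″<t) q) prems)
      (All.map (Bounded⇒⊨ Σ₁-σ) orcs)

  Justified-mono : ∀ (S S′ : ℕ → Set) {B B′ u} → (∀ u → S u → S′ u) → B ≤ B′ →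
                   Justified S B u → Justified S′ B′ u
  Justified-mono S S′ S⊆S′ B≤B′ (g , i , t , t<B , v , v<B , e , prems , orcs) =
    g , i , t , <-≤-trans t<B B≤B′ , v , Allᵛ.map (λ a<B → <-≤-trans a<B B≤B′) v<B , e ,
    All.map (λ (t′ , t′<t , p) → t′ , t′<t , S⊆S′ _ p) prems ,
    All.map (Bounded-mono Σ₁-σ B≤B′) orcs

  -- A backward closed set before it is coded. Here `B` bounds only the data of the inferences; a
  -- bound on the entries themselves is added in `Traced⇒Recorded`.
  Trace : ℕ → List ℕ → Set
  Trace B us = All (Justified (_∈ˡ us) B) us

  Trace-++ : ∀ {B B′ us us′} → Trace B us → Trace B′ us′ → Trace (B ⊔ B′) (us List.++ us′)
  Trace-++ {B} {B′} {us} {us′} p q = ++⁺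
    (All.map (Justified-mono (_∈ˡ us) (_∈ˡ us List.++ us′) (λ _ → ∈-++⁺ˡ) (m≤m⊔n B B′)) p)
    (All.map (Justified-mono (_∈ˡ us′) (_∈ˡ us List.++ us′) (λ _ → ∈-++⁺ʳ us) (m≤n⊔m B B′)) q)

  upper-bound : ∀ us → ∃ λ B → All (_< B) us
  upper-bound []       = 0 , []
  upper-bound (u ∷ us) with upper-bound us
  ... | B , us<B = suc u ⊔ B , m≤m⊔n (suc u) B ∷ All.map (λ a<B → <-≤-trans a<B (m≤n⊔m (suc u) B)) us<B

  upper-boundᵛ : (v : Vec ℕ k) → ∃ λ B → Allᵛ (_< B) v
  upper-boundᵛ []      = 0 , []
  upper-boundᵛ (a ∷ v) with upper-boundᵛ v
  ... | B , v<B = suc a ⊔ B , m≤m⊔n (suc a) B ∷ Allᵛ.map (λ b<B → <-≤-trans b<B (m≤n⊔m (suc a) B)) v<B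

  Traced : Fin tags → Vec ℕ width → Set
  Traced g y = ∃ λ us → ∃ λ B → ∃ λ t → t < B × entry t g y ∈ˡ us × Trace B us

  Tracedᴸ : Vec ℕ k → List (Fin tags × Vec (Term k) width) → Set
  Tracedᴸ v ps = ∃ λ us → ∃ λ B →
    All (λ (h , p) → ∃ λ t → t < B × entry t h (instantiate v p) ∈ˡ us) ps × Trace B us

  oracle-bound : (v : Vec ℕ k) → ∀ {os} → All (λ o → evalₜ v o ∷ [] ⊨ σ) os →
                 ¬ ¬ ∃ λ B → All (λ o → Bounded Σ₁-σ B (evalₜ v o ∷ [])) os
  oracle-bound v []       ¬B = ¬B (0 , [])
  oracle-bound v (p ∷ ps) ¬B = ⊨⇒Bounded Σ₁-σ p λ (B , b) → oracle-bound v ps λ (B′ , bs) →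
    ¬B (B ⊔ B′ , Bounded-mono Σ₁-σ (m≤m⊔n B B′) b ∷ All.map (Bounded-mono Σ₁-σ (m≤n⊔m B B′)) bs)

  traced  : ∀ {g y} → Derivable g y → ¬ ¬ Traced g y
  tracedᴸ : ∀ (v : Vec ℕ k) {ps} → All (λ (h , p) → Derivable h (instantiate v p)) ps →
            ¬ ¬ Tracedᴸ v ps
  traced {g} (node i v prems orcs) ¬t = tracedᴸ v prems λ (us , B , hs , tr) →
    oracle-bound v orcs λ (B₁ , os) →
    let B₂ , v<B₂ = upper-boundᵛ v
        -- The premises have stamps below `B`, so `B` itself serves as the stamp of the conclusion
        -- and the new bound must exceed it.
        B₃ = suc B ⊔ (B₁ ⊔ B₂)
        B₁≤ = ≤-trans (m≤m⊔n B₁ B₂) (m≤n⊔m (suc B) (B₁ ⊔ B₂))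
        B₂≤ = ≤-trans (m≤n⊔m B₁ B₂) (m≤n⊔m (suc B) (B₁ ⊔ B₂))
        B≤  = ≤-trans (<⇒≤ (n<1+n B)) (m≤m⊔n (suc B) (B₁ ⊔ B₂))
        u  = entry B g (instantiate v (conclusion (the-rule g i)))
    in ¬t (u ∷ us , B₃ , B , m≤m⊔n (suc B) (B₁ ⊔ B₂) , here refl ,
      (g , i , B , m≤m⊔n (suc B) (B₁ ⊔ B₂) , v , Allᵛ.map (λ a<B → <-≤-trans a<B B₂≤) v<B₂ , refl ,
        All.map (λ (t , t<B , p) → t , t<B , there p) hs , All.map (Bounded-mono Σ₁-σ B₁≤) os)
      ∷ All.map (Justified-mono (_∈ˡ us) (_∈ˡ u ∷ us) (λ _ → there) B≤) tr)
  tracedᴸ v []       ¬t = ¬t ([] , 0 , [] , [])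
  tracedᴸ v (p ∷ ps) ¬t = traced p λ (us , B , t , t<B , u∈us , tr) →
    tracedᴸ v ps λ (us′ , B′ , hs , tr′) →
    ¬t (us List.++ us′ , B ⊔ B′ ,
      (t , <-≤-trans t<B (m≤m⊔n B B′) , ∈-++⁺ˡ u∈us)
      ∷ All.map (λ (t′ , t′<B′ , q) → t′ , <-≤-trans t′<B′ (m≤n⊔m B B′) , ∈-++⁺ʳ us q) hs ,
      Trace-++ tr tr′)

  -- The bound is first enlarged beyond all entries, so that with m = `B !` divisibility of the code
  -- is the same as membership in the list.
  Traced⇒Recorded : ∀ g y → Traced g y → ∃ λ B → ∃ λ m → ∃ λ c → Recorded g B m c y
  Traced⇒Recorded g y (us , B₀ , t , t<B₀ , u∈us , tr) =
    B , B ! , c , closed , t , <-≤-trans t<B₀ B₀≤B , ∈⇒Member _ u∈us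
    where
    B₁ = proj₁ (upper-bound us)
    B  = B₀ ⊔ B₁
    c  = setCode (B !) us
    B₀≤B : B₀ ≤ B
    B₀≤B = m≤m⊔n B₀ B₁
    us<B : All (_< B) us
    us<B = All.map (λ u<B₁ → <-≤-trans u<B₁ (m≤n⊔m B₀ B₁)) (proj₂ (upper-bound us))
    ∈⇒Member : ∀ u → u ∈ˡ us → Member B (B !) c u
    ∈⇒Member u u∈us with ∈⇒∣setCode (B !) u∈us
    ... | divides q e = All.lookup us<B u∈us , q ,
      -- The quotient is at most the code because a divisor is at least 1.
      s≤s (≡-subst (q ≤_) (sym e) (m≤m*n q (divisor (B !) u))) , e
    closed : Closed B (B !) c
    closed u u<B (_ , q , _ , e) = Justified-mono (_∈ˡ us) (Member B (B !) c) ∈⇒Member B₀≤B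
      (All.lookup tr (∣setCode⇒∈ us<B u<B (divides q e)))

  -- Abstract because the normal form of the formula is enormous.
  abstract

    derivable : Fin tags → Vec (Term n) width → Formula n
    derivable g ts = ∃' ∃' ∃' Recordedᴰ g ts .Definable.formula

    Σ₁-derivable : ∀ g (ts : Vec (Term n) width) → Σ₁ (derivable g ts)
    Σ₁-derivable g ts = ex (ex (ex (base (Recordedᴰ g ts .Definable.isΔ₀))))

    derivable⁺ : ∀ g (ts : Vec (Term n) width) ρ →
                 Derivable g (instantiate ρ ts) → ρ ⊨ derivable g ts
    derivable⁺ g ts ρ d ¬c = traced d λ t → let B , m , c , r = Traced⇒Recorded g (instantiate ρ ts) t in
      ¬c c λ ¬m → ¬m m λ ¬B → ¬B B (Recordedᴰ g ts .Definable.from (B , m , c , ρ) r)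

    derivable⁻ : ∀ g (ts : Vec (Term n) width) ρ →
                 ρ ⊨ derivable g ts → ¬ ¬ Derivable g (instantiate ρ ts)
    derivable⁻ g ts ρ h ¬d = h λ c hm → hm λ m hB → hB λ B r →
      ¬d (Recorded⇒Derivable {g} {y = instantiate ρ ts} (Recordedᴰ g ts .Definable.to (B , m , c , ρ) r))

-- Gödel numbers

-- Presenting every code uniformly as a pair gives one inversion lemma for all constructors; an
-- impossible equation of tags then excludes the wrong ones.
tagₜ payloadₜ : Term n → ℕ
tagₜ (var i) = 0
tagₜ 𝟎       = 1
tagₜ 𝟏       = 2
tagₜ (s ⊕ t) = 3
tagₜ (s ⊗ t) = 4
payloadₜ (var i) = toℕ i
payloadₜ 𝟎       = 0
payloadₜ 𝟏       = 0
payloadₜ (s ⊕ t) = ⟪ ⌜ s ⌝ₜ , ⌜ t ⌝ₜ ⟫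
payloadₜ (s ⊗ t) = ⟪ ⌜ s ⌝ₜ , ⌜ t ⌝ₜ ⟫

tag payload : Formula n → ℕ
tag ⊥'      = 0
tag (s ≐ t) = 1
tag (s ≺ t) = 2
tag (φ ⇒ ψ) = 3
tag (∀' φ)  = 4
payload ⊥'      = 0
payload (s ≐ t) = ⟪ ⌜ s ⌝ₜ , ⌜ t ⌝ₜ ⟫
payload (s ≺ t) = ⟪ ⌜ s ⌝ₜ , ⌜ t ⌝ₜ ⟫
payload (φ ⇒ ψ) = ⟪ ⌜ φ ⌝ , ⌜ ψ ⌝ ⟫
payload (∀' φ)  = ⌜ φ ⌝

⌜⌝ₜ-code : (t : Term n) → ⌜ t ⌝ₜ ≡ ⟪ tagₜ t , payloadₜ t ⟫
⌜⌝ₜ-code (var i) = refl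
⌜⌝ₜ-code 𝟎       = refl
⌜⌝ₜ-code 𝟏       = refl
⌜⌝ₜ-code (s ⊕ t) = refl
⌜⌝ₜ-code (s ⊗ t) = refl

⌜⌝-code : (φ : Formula n) → ⌜ φ ⌝ ≡ ⟪ tag φ , payload φ ⟫
⌜⌝-code ⊥'      = refl
⌜⌝-code (s ≐ t) = refl
⌜⌝-code (s ≺ t) = refl
⌜⌝-code (φ ⇒ ψ) = refl
⌜⌝-code (∀' φ)  = refl

⌜⌝ₜ-invert : (t : Term n) → ∀ c p → ⌜ t ⌝ₜ ≡ ⟪ c , p ⟫ → tagₜ t ≡ c × payloadₜ t ≡ p
⌜⌝ₜ-invert t c p e = ⟪⟫-injective (tagₜ t) (payloadₜ t) c p (trans (sym (⌜⌝ₜ-code t)) e)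

⌜⌝-invert : (φ : Formula n) → ∀ c p → ⌜ φ ⌝ ≡ ⟪ c , p ⟫ → tag φ ≡ c × payload φ ≡ p
⌜⌝-invert φ c p e = ⟪⟫-injective (tag φ) (payload φ) c p (trans (sym (⌜⌝-code φ)) e)

⌜⌝ₜ-injective : (s t : Term n) → ⌜ s ⌝ₜ ≡ ⌜ t ⌝ₜ → s ≡ t
injectiveₜ : (s t : Term n) → tagₜ s ≡ tagₜ t → payloadₜ s ≡ payloadₜ t → s ≡ t
⌜⌝ₜ-injective s t e with ⌜⌝ₜ-invert s (tagₜ t) (payloadₜ t) (trans e (⌜⌝ₜ-code t))
... | p , q = injectiveₜ s t p q
injectiveₜ (var i) (var j) _ q = cong var (toℕ-injective q)
injectiveₜ 𝟎 𝟎 _ _ = refl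
injectiveₜ 𝟏 𝟏 _ _ = refl
injectiveₜ (s ⊕ t) (s′ ⊕ t′) _ q with ⟪⟫-injective ⌜ s ⌝ₜ ⌜ t ⌝ₜ ⌜ s′ ⌝ₜ ⌜ t′ ⌝ₜ q
... | d , e = cong₂ _⊕_ (⌜⌝ₜ-injective s s′ d) (⌜⌝ₜ-injective t t′ e)
injectiveₜ (s ⊗ t) (s′ ⊗ t′) _ q with ⟪⟫-injective ⌜ s ⌝ₜ ⌜ t ⌝ₜ ⌜ s′ ⌝ₜ ⌜ t′ ⌝ₜ q
... | d , e = cong₂ _⊗_ (⌜⌝ₜ-injective s s′ d) (⌜⌝ₜ-injective t t′ e)

⌜⌝-injective : (φ ψ : Formula n) → ⌜ φ ⌝ ≡ ⌜ ψ ⌝ → φ ≡ ψ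
injective : (φ ψ : Formula n) → tag φ ≡ tag ψ → payload φ ≡ payload ψ → φ ≡ ψ
⌜⌝-injective φ ψ e with ⌜⌝-invert φ (tag ψ) (payload ψ) (trans e (⌜⌝-code ψ))
... | p , q = injective φ ψ p q
injective ⊥' ⊥' _ _ = refl
injective (s ≐ t) (s′ ≐ t′) _ q with ⟪⟫-injective ⌜ s ⌝ₜ ⌜ t ⌝ₜ ⌜ s′ ⌝ₜ ⌜ t′ ⌝ₜ q
... | d , e = cong₂ _≐_ (⌜⌝ₜ-injective s s′ d) (⌜⌝ₜ-injective t t′ e)
injective (s ≺ t) (s′ ≺ t′) _ q with ⟪⟫-injective ⌜ s ⌝ₜ ⌜ t ⌝ₜ ⌜ s′ ⌝ₜ ⌜ t′ ⌝ₜ q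
... | d , e = cong₂ _≺_ (⌜⌝ₜ-injective s s′ d) (⌜⌝ₜ-injective t t′ e)
injective (φ ⇒ ψ) (φ′ ⇒ ψ′) _ q with ⟪⟫-injective ⌜ φ ⌝ ⌜ ψ ⌝ ⌜ φ′ ⌝ ⌜ ψ′ ⌝ q
... | d , e = cong₂ _⇒_ (⌜⌝-injective φ φ′ d) (⌜⌝-injective ψ ψ′ e)
injective (∀' φ) (∀' ψ) _ q = cong ∀'_ (⌜⌝-injective φ ψ q)

-- Gödel numbers do not record the number of variables in scope.
PreservesIndices : Subst n m → Set
PreservesIndices {m = m} σ = ∀ i → ∃ λ (j : Fin m) → σ i ≡ var j × toℕ j ≡ toℕ i

⌜substₜ⌝ : {σ : Subst n m} → PreservesIndices σ → ∀ t → ⌜ substₜ σ t ⌝ₜ ≡ ⌜ t ⌝ₜ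
⌜substₜ⌝ h (var i) with h i
... | j , e , e′ = trans (cong ⌜_⌝ₜ e) (cong ⟪ 0 ,_⟫ e′)
⌜substₜ⌝ h 𝟎       = refl
⌜substₜ⌝ h 𝟏       = refl
⌜substₜ⌝ h (s ⊕ t) = cong₂ (λ a b → ⟪ 3 , ⟪ a , b ⟫ ⟫) (⌜substₜ⌝ h s) (⌜substₜ⌝ h t)
⌜substₜ⌝ h (s ⊗ t) = cong₂ (λ a b → ⟪ 4 , ⟪ a , b ⟫ ⟫) (⌜substₜ⌝ h s) (⌜substₜ⌝ h t)

⌜subst⌝ : {σ : Subst n m} → PreservesIndices σ → ∀ φ → ⌜ subst σ φ ⌝ ≡ ⌜ φ ⌝
⌜subst⌝ h ⊥'      = refl
⌜subst⌝ h (s ≐ t) = cong₂ (λ a b → ⟪ 1 , ⟪ a , b ⟫ ⟫) (⌜substₜ⌝ h s) (⌜substₜ⌝ h t)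
⌜subst⌝ h (s ≺ t) = cong₂ (λ a b → ⟪ 2 , ⟪ a , b ⟫ ⟫) (⌜substₜ⌝ h s) (⌜substₜ⌝ h t)
⌜subst⌝ h (φ ⇒ ψ) = cong₂ (λ a b → ⟪ 3 , ⟪ a , b ⟫ ⟫) (⌜subst⌝ h φ) (⌜subst⌝ h ψ)
⌜subst⌝ {σ = σ} h (∀' φ) = cong ⟪ 4 ,_⟫ (⌜subst⌝ h↑ φ)
  where
  h↑ : PreservesIndices (lift σ)
  h↑ zero    = zero , refl , refl
  h↑ (suc i) with h i
  ... | j , e , e′ = suc j , cong shiftₜ e , cong suc e′

-- An axiom keeps its code in every scope, so the clause for `ax` can pass the code of its
-- conclusion straight to the oracle.
⌜embed⌝ : ∀ {n} (φ : Sentence) → ⌜ embed {n} φ ⌝ ≡ ⌜ φ ⌝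
⌜embed⌝ = ⌜subst⌝ λ ()

⌜numeral⌝ : ∀ {n m} a → ⌜ numeral {n} a ⌝ₜ ≡ ⌜ numeral {m} a ⌝ₜ
⌜numeral⌝ zero          = refl
⌜numeral⌝ (suc zero)    = refl
⌜numeral⌝ (suc (suc a)) = cong (λ c → ⟪ 3 , ⟪ c , ⟪ 2 , 0 ⟫ ⟫ ⟫) (⌜numeral⌝ (suc a))

-- The successor keeps nonempty contexts apart from the empty one, since `⟪ 0 , 0 ⟫` is 0.
⌜_⌝ᶜ : List (Formula n) → ℕ
⌜ [] ⌝ᶜ    = 0
⌜ φ ∷ Γ ⌝ᶜ = suc ⟪ ⌜ φ ⌝ , ⌜ Γ ⌝ᶜ ⟫

-- The substitutions that occur in derivations, given by syntax so that they
-- too have codes.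
data Substitution : ℕ → ℕ → Set where
  weakening     : Substitution n (suc n)
  instantiation : Term n → Substitution (suc n) n
  lifting       : Substitution n m → Substitution (suc n) (suc m)

⟦_⟧ : Substitution n m → Subst n m
⟦ weakening ⟧       = λ i → var (suc i)
⟦ instantiation t ⟧ = inst t
⟦ lifting s ⟧       = lift ⟦ s ⟧

⌜_⌝ₛ tagₛ payloadₛ : Substitution n m → ℕ
⌜ weakening ⌝ₛ       = ⟪ 0 , 0 ⟫
⌜ instantiation t ⌝ₛ = ⟪ 1 , ⌜ t ⌝ₜ ⟫
⌜ lifting s ⌝ₛ       = ⟪ 2 , ⌜ s ⌝ₛ ⟫
tagₛ weakening         = 0
tagₛ (instantiation t) = 1
tagₛ (lifting s)       = 2
payloadₛ weakening         = 0
payloadₛ (instantiation t) = ⌜ t ⌝ₜ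
payloadₛ (lifting s)       = ⌜ s ⌝ₛ

⌜⌝ₛ-invert : (s : Substitution n m) → ∀ c p → ⌜ s ⌝ₛ ≡ ⟪ c , p ⟫ → tagₛ s ≡ c × payloadₛ s ≡ p
⌜⌝ₛ-invert s c p e = ⟪⟫-injective (tagₛ s) (payloadₛ s) c p (trans (sym (code s)) e)
  where
  code : (s : Substitution n m) → ⌜ s ⌝ₛ ≡ ⟪ tagₛ s , payloadₛ s ⟫
  code weakening         = refl
  code (instantiation t) = refl
  code (lifting s)       = refl

-- Provability as a system of Horn clauses

pattern x₄ = var (suc (suc (suc (suc zero))))
pattern x₅ = var (suc (suc (suc (suc (suc zero)))))

Judgement : ℕ → Set
Judgement k = Fin 9 × Vec (Term k) 3

pattern term-tag  = 0F
pattern form-tag  = 1F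
pattern subₜ-tag  = 2F
pattern sub-tag   = 3F
pattern shift-tag = 4F
pattern mem-tag   = 5F
pattern num-tag   = 6F
pattern prov-tag  = 7F
pattern diag-tag  = 8F

con : ℕ → Term k → Term k
con c t = pairₜ (numeral c) t

con₂ : ℕ → Term k → Term k → Term k
con₂ c s t = con c (pairₜ s t)

cons : Term k → Term k → Term k
cons a Γ = 𝟏 ⊕ pairₜ a Γ

⊢term ⊢form ⊢shift ⊢mem ⊢num : Term k → Term k → Judgement k
⊢term  n t = term-tag  , n ∷ t ∷ 𝟎 ∷ []
⊢form  n a = form-tag  , n ∷ a ∷ 𝟎 ∷ []
⊢shift Γ Δ = shift-tag , Γ ∷ Δ ∷ 𝟎 ∷ []
⊢mem   a Γ = mem-tag   , a ∷ Γ ∷ 𝟎 ∷ []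
⊢num   x t = num-tag   , x ∷ t ∷ 𝟎 ∷ []

⊢subₜ ⊢sub ⊢prov : Term k → Term k → Term k → Judgement k
⊢subₜ s a b = subₜ-tag , s ∷ a ∷ b ∷ []
⊢sub  s a b = sub-tag  , s ∷ a ∷ b ∷ []
⊢prov n Γ a = prov-tag , n ∷ Γ ∷ a ∷ []

-- A side condition i < n is expressed by writing n as i + (1 + e).  The clauses
-- of prov-tag are, in this order, ax, hyp, ⇒I, ⇒E, raa, ∀I and ∀E.
rules : Fin 9 → List (Rule 9 3)
rules term-tag =
  rule 2 (x₀ ⊕ (𝟏 ⊕ x₁) ∷ con 0 x₀ ∷ 𝟎 ∷ []) [] [] ∷
  rule 1 (x₀ ∷ con 1 𝟎 ∷ 𝟎 ∷ []) [] [] ∷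
  rule 1 (x₀ ∷ con 2 𝟎 ∷ 𝟎 ∷ []) [] [] ∷
  rule 3 (x₀ ∷ con₂ 3 x₁ x₂ ∷ 𝟎 ∷ []) (⊢term x₀ x₁ ∷ ⊢term x₀ x₂ ∷ []) [] ∷
  rule 3 (x₀ ∷ con₂ 4 x₁ x₂ ∷ 𝟎 ∷ []) (⊢term x₀ x₁ ∷ ⊢term x₀ x₂ ∷ []) [] ∷ []
rules form-tag =
  rule 1 (x₀ ∷ con 0 𝟎 ∷ 𝟎 ∷ []) [] [] ∷
  rule 3 (x₀ ∷ con₂ 1 x₁ x₂ ∷ 𝟎 ∷ []) (⊢term x₀ x₁ ∷ ⊢term x₀ x₂ ∷ []) [] ∷
  rule 3 (x₀ ∷ con₂ 2 x₁ x₂ ∷ 𝟎 ∷ []) (⊢term x₀ x₁ ∷ ⊢term x₀ x₂ ∷ []) [] ∷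
  rule 3 (x₀ ∷ con₂ 3 x₁ x₂ ∷ 𝟎 ∷ []) (⊢form x₀ x₁ ∷ ⊢form x₀ x₂ ∷ []) [] ∷
  rule 2 (x₀ ∷ con 4 x₁ ∷ 𝟎 ∷ []) (⊢form (𝟏 ⊕ x₀) x₁ ∷ []) [] ∷ []
rules subₜ-tag =
  rule 1 (con 0 𝟎 ∷ con 0 x₀ ∷ con 0 (𝟏 ⊕ x₀) ∷ []) [] [] ∷
  rule 1 (con 1 x₀ ∷ con 0 𝟎 ∷ x₀ ∷ []) [] [] ∷
  rule 2 (con 1 x₀ ∷ con 0 (𝟏 ⊕ x₁) ∷ con 0 x₁ ∷ []) [] [] ∷
  rule 1 (con 2 x₀ ∷ con 0 𝟎 ∷ con 0 𝟎 ∷ []) [] [] ∷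
  -- Under a lifting, variable i + 1 goes to the weakening, coded `con 0 𝟎`, of the image `x₂` of
  -- variable i.
  rule 4 (con 2 x₀ ∷ con 0 (𝟏 ⊕ x₁) ∷ x₃ ∷ [])
    (⊢subₜ x₀ (con 0 x₁) x₂ ∷ ⊢subₜ (con 0 𝟎) x₂ x₃ ∷ []) [] ∷
  rule 1 (x₀ ∷ con 1 𝟎 ∷ con 1 𝟎 ∷ []) [] [] ∷
  rule 1 (x₀ ∷ con 2 𝟎 ∷ con 2 𝟎 ∷ []) [] [] ∷
  rule 5 (x₀ ∷ con₂ 3 x₁ x₂ ∷ con₂ 3 x₃ x₄ ∷ []) (⊢subₜ x₀ x₁ x₃ ∷ ⊢subₜ x₀ x₂ x₄ ∷ []) [] ∷
  rule 5 (x₀ ∷ con₂ 4 x₁ x₂ ∷ con₂ 4 x₃ x₄ ∷ []) (⊢subₜ x₀ x₁ x₃ ∷ ⊢subₜ x₀ x₂ x₄ ∷ []) [] ∷ []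
rules sub-tag =
  rule 1 (x₀ ∷ con 0 𝟎 ∷ con 0 𝟎 ∷ []) [] [] ∷
  rule 5 (x₀ ∷ con₂ 1 x₁ x₂ ∷ con₂ 1 x₃ x₄ ∷ []) (⊢subₜ x₀ x₁ x₃ ∷ ⊢subₜ x₀ x₂ x₄ ∷ []) [] ∷
  rule 5 (x₀ ∷ con₂ 2 x₁ x₂ ∷ con₂ 2 x₃ x₄ ∷ []) (⊢subₜ x₀ x₁ x₃ ∷ ⊢subₜ x₀ x₂ x₄ ∷ []) [] ∷
  rule 5 (x₀ ∷ con₂ 3 x₁ x₂ ∷ con₂ 3 x₃ x₄ ∷ []) (⊢sub x₀ x₁ x₃ ∷ ⊢sub x₀ x₂ x₄ ∷ []) [] ∷
  rule 3 (x₀ ∷ con 4 x₁ ∷ con 4 x₂ ∷ []) (⊢sub (con 2 x₀) x₁ x₂ ∷ []) [] ∷ []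
rules shift-tag =
  rule 0 (𝟎 ∷ 𝟎 ∷ 𝟎 ∷ []) [] [] ∷
  rule 4 (cons x₀ x₂ ∷ cons x₁ x₃ ∷ 𝟎 ∷ []) (⊢sub (con 0 𝟎) x₀ x₁ ∷ ⊢shift x₂ x₃ ∷ []) [] ∷ []
rules mem-tag =
  rule 2 (x₀ ∷ cons x₀ x₁ ∷ 𝟎 ∷ []) [] [] ∷
  rule 3 (x₀ ∷ cons x₁ x₂ ∷ 𝟎 ∷ []) (⊢mem x₀ x₂ ∷ []) [] ∷ []
rules num-tag =
  rule 0 (𝟎 ∷ con 1 𝟎 ∷ 𝟎 ∷ []) [] [] ∷
  rule 0 (𝟏 ∷ con 2 𝟎 ∷ 𝟎 ∷ []) [] [] ∷
  rule 2 (𝟏 ⊕ (𝟏 ⊕ x₀) ∷ con₂ 3 x₁ (con 2 𝟎) ∷ 𝟎 ∷ []) (⊢num (𝟏 ⊕ x₀) x₁ ∷ []) [] ∷ []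
rules prov-tag =
  rule 3 (x₀ ∷ x₁ ∷ x₂ ∷ []) [] (x₂ ∷ []) ∷
  rule 3 (x₀ ∷ x₁ ∷ x₂ ∷ []) (⊢mem x₂ x₁ ∷ []) [] ∷
  rule 4 (x₀ ∷ x₁ ∷ con₂ 3 x₂ x₃ ∷ []) (⊢prov x₀ (cons x₂ x₁) x₃ ∷ []) [] ∷
  -- The cut formula does not occur in the conclusion, so a premise must ensure that `x₂` codes a
  -- formula in scope. The clause for ∀E does the same for its formula and its term.
  rule 4 (x₀ ∷ x₁ ∷ x₃ ∷ [])
    (⊢form x₀ x₂ ∷ ⊢prov x₀ x₁ (con₂ 3 x₂ x₃) ∷ ⊢prov x₀ x₁ x₂ ∷ []) [] ∷
  rule 3 (x₀ ∷ x₁ ∷ x₂ ∷ [])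
    (⊢prov x₀ (cons (con₂ 3 x₂ (con 0 𝟎)) x₁) (con 0 𝟎) ∷ []) [] ∷
  rule 4 (x₀ ∷ x₁ ∷ con 4 x₃ ∷ []) (⊢shift x₁ x₂ ∷ ⊢prov (𝟏 ⊕ x₀) x₂ x₃ ∷ []) [] ∷
  rule 5 (x₀ ∷ x₁ ∷ x₄ ∷ [])
    (⊢form (𝟏 ⊕ x₀) x₂ ∷ ⊢term x₀ x₃ ∷ ⊢sub (con 1 x₃) x₂ x₄ ∷ ⊢prov x₀ x₁ (con 4 x₂) ∷ []) [] ∷ []
rules diag-tag =
  -- Here `x₁` codes the numeral of `x₀`, and `x₂` the result of substituting it into the formula
  -- coded by `x₀`.
  rule 3 (x₀ ∷ 𝟎 ∷ 𝟎 ∷ [])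
    (⊢num x₀ x₁ ∷ ⊢sub (con 1 x₁) x₀ x₂ ∷ ⊢prov 𝟎 𝟎 (con₂ 3 x₂ (con 0 𝟎)) ∷ []) [] ∷ []

module Provability {σ : Formula 1} (Σ₁-σ : Σ₁ σ)
                   (coded : ∀ {a} → a ∷ [] ⊨ σ → ∃ λ (χ : Sentence) → ⌜ χ ⌝ ≡ a) where

  open Horn rules Σ₁-σ
  open Rule

  -- Being an axiom is replaced by what the oracle tests, the truth of `σ` at the code.
  T : Theory 0ℓ
  T φ = ⌜ φ ⌝ ∷ [] ⊨ σ

  -- Soundness

  -- Only `term-tag` and `form-tag` provide decodings. The judgements on substitutions, contexts and
  -- provability speak about given decodings, since their clauses also derive judgements about
  -- numbers that code nothing.
  Meaning : Fin 9 → Vec ℕ 3 → Set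
  Meaning term-tag  (n ∷ t ∷ _ ∷ []) = ∃ λ (u : Term n) → ⌜ u ⌝ₜ ≡ t
  Meaning form-tag  (n ∷ a ∷ _ ∷ []) = ∃ λ (φ : Formula n) → ⌜ φ ⌝ ≡ a
  Meaning subₜ-tag  (s ∷ a ∷ b ∷ []) = ∀ {n m} (τ : Substitution n m) t →
    ⌜ τ ⌝ₛ ≡ s → ⌜ t ⌝ₜ ≡ a → ⌜ substₜ ⟦ τ ⟧ t ⌝ₜ ≡ b
  Meaning sub-tag   (s ∷ a ∷ b ∷ []) = ∀ {n m} (τ : Substitution n m) φ →
    ⌜ τ ⌝ₛ ≡ s → ⌜ φ ⌝ ≡ a → ⌜ subst ⟦ τ ⟧ φ ⌝ ≡ b
  Meaning shift-tag (a ∷ b ∷ _ ∷ []) = ∀ {n} (Γ : List (Formula n)) →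
    ⌜ Γ ⌝ᶜ ≡ a → ⌜ map shift Γ ⌝ᶜ ≡ b
  Meaning mem-tag   (a ∷ b ∷ _ ∷ []) = ∀ {n} φ (Γ : List (Formula n)) →
    ⌜ φ ⌝ ≡ a → ⌜ Γ ⌝ᶜ ≡ b → φ ∈ˡ Γ
  Meaning num-tag   (a ∷ b ∷ _ ∷ []) = ⌜ numeral {0} a ⌝ₜ ≡ b
  Meaning prov-tag  (n ∷ b ∷ a ∷ []) = ∀ (Γ : List (Formula n)) φ →
    ⌜ Γ ⌝ᶜ ≡ b → ⌜ φ ⌝ ≡ a → T ∣ Γ ⊢ φ
  Meaning diag-tag  (a ∷ _ ∷ _ ∷ []) = ∀ (ψ : Formula 1) →
    ⌜ ψ ⌝ ≡ a → T ⊢ ¬' (ψ [ numeral a ])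

  sound : ∀ g i v →
          All (λ (h , p) → Meaning h (instantiate v p)) (premises (the-rule g i)) →
          All (λ o → evalₜ v o ∷ [] ⊨ σ) (oracles (the-rule g i)) →
          Meaning g (instantiate v (conclusion (the-rule g i)))
  sound term-tag 0F (i ∷ e ∷ []) [] [] =
    var (fromℕ< i<n) , cong ⟪ 0 ,_⟫ (toℕ-fromℕ< i<n)
    where
    i<n : i < i + suc e
    i<n = m<m+n i z<s
  sound term-tag 1F _ [] [] = 𝟎 , refl
  sound term-tag 2F _ [] [] = 𝟏 , refl
  sound term-tag 3F (n ∷ a ∷ b ∷ []) ((s , p) ∷ (t , q) ∷ []) [] =
    s ⊕ t , cong₂ (λ a b → ⟪ 3 , ⟪ a , b ⟫ ⟫) p q
  sound term-tag 4F (n ∷ a ∷ b ∷ []) ((s , p) ∷ (t , q) ∷ []) [] =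
    s ⊗ t , cong₂ (λ a b → ⟪ 4 , ⟪ a , b ⟫ ⟫) p q
  sound form-tag 0F _ [] [] = ⊥' , refl
  sound form-tag 1F (n ∷ a ∷ b ∷ []) ((s , p) ∷ (t , q) ∷ []) [] =
    s ≐ t , cong₂ (λ a b → ⟪ 1 , ⟪ a , b ⟫ ⟫) p q
  sound form-tag 2F (n ∷ a ∷ b ∷ []) ((s , p) ∷ (t , q) ∷ []) [] =
    s ≺ t , cong₂ (λ a b → ⟪ 2 , ⟪ a , b ⟫ ⟫) p q
  sound form-tag 3F (n ∷ a ∷ b ∷ []) ((φ , p) ∷ (ψ , q) ∷ []) [] =
    (φ ⇒ ψ) , cong₂ (λ a b → ⟪ 3 , ⟪ a , b ⟫ ⟫) p q
  sound form-tag 4F (n ∷ a ∷ []) ((φ , p) ∷ []) [] = ∀' φ , cong ⟪ 4 ,_⟫ p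
  sound subₜ-tag 0F (i ∷ []) [] [] τ t es et
    with τ | ⌜⌝ₛ-invert τ 0 0 es | t | ⌜⌝ₜ-invert t 0 i et
  ... | weakening | _ , _ | var j | _ , refl = refl
  sound subₜ-tag 1F (a ∷ []) [] [] τ t es et
    with τ | ⌜⌝ₛ-invert τ 1 a es | t | ⌜⌝ₜ-invert t 0 0 et
  ... | instantiation u | _ , e | var zero | _ , _ = e
  sound subₜ-tag 2F (a ∷ i ∷ []) [] [] τ t es et
    with τ | ⌜⌝ₛ-invert τ 1 a es | t | ⌜⌝ₜ-invert t 0 (suc i) et
  ... | instantiation u | _ , e | var (suc j) | _ , refl = refl
  sound subₜ-tag 3F (s ∷ []) [] [] τ t es et
    with τ | ⌜⌝ₛ-invert τ 2 s es | t | ⌜⌝ₜ-invert t 0 0 et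
  ... | lifting τ′ | _ , e | var zero | _ , _ = refl
  sound subₜ-tag 4F (s ∷ i ∷ a ∷ b ∷ []) (p ∷ q ∷ []) [] τ t es et
    with τ | ⌜⌝ₛ-invert τ 2 s es | t | ⌜⌝ₜ-invert t 0 (suc i) et
  ... | lifting τ′ | _ , e | var (suc j) | _ , refl =
    q weakening (⟦ τ′ ⟧ j) refl (p τ′ (var j) e refl)
  sound subₜ-tag 5F (s ∷ []) [] [] τ t es et with t | ⌜⌝ₜ-invert t 1 0 et
  ... | 𝟎 | _ , _ = refl
  sound subₜ-tag 6F (s ∷ []) [] [] τ t es et with t | ⌜⌝ₜ-invert t 2 0 et
  ... | 𝟏 | _ , _ = refl
  sound subₜ-tag 7F (s ∷ a ∷ b ∷ c ∷ d ∷ []) (p ∷ q ∷ []) [] τ t es et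
    with t | ⌜⌝ₜ-invert t 3 ⟪ a , b ⟫ et
  ... | t₁ ⊕ t₂ | _ , e with ⟪⟫-injective ⌜ t₁ ⌝ₜ ⌜ t₂ ⌝ₜ a b e
  ... | e₁ , e₂ = cong₂ (λ a b → ⟪ 3 , ⟪ a , b ⟫ ⟫) (p τ t₁ es e₁) (q τ t₂ es e₂)
  sound subₜ-tag 8F (s ∷ a ∷ b ∷ c ∷ d ∷ []) (p ∷ q ∷ []) [] τ t es et
    with t | ⌜⌝ₜ-invert t 4 ⟪ a , b ⟫ et
  ... | t₁ ⊗ t₂ | _ , e with ⟪⟫-injective ⌜ t₁ ⌝ₜ ⌜ t₂ ⌝ₜ a b e
  ... | e₁ , e₂ = cong₂ (λ a b → ⟪ 4 , ⟪ a , b ⟫ ⟫) (p τ t₁ es e₁) (q τ t₂ es e₂)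
  sound sub-tag 0F (s ∷ []) [] [] τ φ es eφ with φ | ⌜⌝-invert φ 0 0 eφ
  ... | ⊥' | _ , _ = refl
  sound sub-tag 1F (s ∷ a ∷ b ∷ c ∷ d ∷ []) (p ∷ q ∷ []) [] τ φ es eφ
    with φ | ⌜⌝-invert φ 1 ⟪ a , b ⟫ eφ
  ... | t₁ ≐ t₂ | _ , e with ⟪⟫-injective ⌜ t₁ ⌝ₜ ⌜ t₂ ⌝ₜ a b e
  ... | e₁ , e₂ = cong₂ (λ a b → ⟪ 1 , ⟪ a , b ⟫ ⟫) (p τ t₁ es e₁) (q τ t₂ es e₂)
  sound sub-tag 2F (s ∷ a ∷ b ∷ c ∷ d ∷ []) (p ∷ q ∷ []) [] τ φ es eφ
    with φ | ⌜⌝-invert φ 2 ⟪ a , b ⟫ eφ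
  ... | t₁ ≺ t₂ | _ , e with ⟪⟫-injective ⌜ t₁ ⌝ₜ ⌜ t₂ ⌝ₜ a b e
  ... | e₁ , e₂ = cong₂ (λ a b → ⟪ 2 , ⟪ a , b ⟫ ⟫) (p τ t₁ es e₁) (q τ t₂ es e₂)
  sound sub-tag 3F (s ∷ a ∷ b ∷ c ∷ d ∷ []) (p ∷ q ∷ []) [] τ φ es eφ
    with φ | ⌜⌝-invert φ 3 ⟪ a , b ⟫ eφ
  ... | φ₁ ⇒ φ₂ | _ , e with ⟪⟫-injective ⌜ φ₁ ⌝ ⌜ φ₂ ⌝ a b e
  ... | e₁ , e₂ = cong₂ (λ a b → ⟪ 3 , ⟪ a , b ⟫ ⟫) (p τ φ₁ es e₁) (q τ φ₂ es e₂)
  sound sub-tag 4F (s ∷ a ∷ b ∷ []) (p ∷ []) [] τ φ es eφ with φ | ⌜⌝-invert φ 4 a eφ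
  ... | ∀' φ′ | _ , e = cong ⟪ 4 ,_⟫ (p (lifting τ) φ′ (cong ⟪ 2 ,_⟫ es) e)
  sound shift-tag 0F [] [] [] []      e = refl
  sound shift-tag 1F (a ∷ b ∷ c ∷ d ∷ []) (p ∷ q ∷ []) [] (φ ∷ Γ) e
    with ⟪⟫-injective ⌜ φ ⌝ ⌜ Γ ⌝ᶜ a c (suc-injective e)
  ... | e₁ , e₂ = cong₂ (λ a b → suc ⟪ a , b ⟫) (p weakening φ refl e₁) (q Γ e₂)
  sound mem-tag 0F (a ∷ b ∷ []) [] [] φ (ψ ∷ Γ) eφ e
    with ⟪⟫-injective ⌜ ψ ⌝ ⌜ Γ ⌝ᶜ a b (suc-injective e)
  ... | e₁ , _ = here (⌜⌝-injective φ ψ (trans eφ (sym e₁)))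
  sound mem-tag 1F (a ∷ b ∷ c ∷ []) (p ∷ []) [] φ (ψ ∷ Γ) eφ e
    with ⟪⟫-injective ⌜ ψ ⌝ ⌜ Γ ⌝ᶜ b c (suc-injective e)
  ... | _ , e₂ = there (p φ Γ eφ e₂)
  sound num-tag 0F [] [] [] = refl
  sound num-tag 1F [] [] [] = refl
  sound num-tag 2F (a ∷ b ∷ []) (p ∷ []) [] = cong (λ c → ⟪ 3 , ⟪ c , ⟪ 2 , 0 ⟫ ⟫ ⟫) p
  -- The oracle yields a sentence with the code of `φ`; its embedding has the same code, so it is
  -- `φ`.
  sound prov-tag 0F (n ∷ b ∷ a ∷ []) [] (p ∷ []) Γ φ eΓ eφ with coded p
  ... | χ , refl = ≡-subst (T ∣ Γ ⊢_) (⌜⌝-injective (embed χ) φ (trans (⌜embed⌝ χ) (sym eφ))) (ax p)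
  sound prov-tag 1F (n ∷ b ∷ a ∷ []) (p ∷ []) [] Γ φ eΓ eφ = hyp (p φ Γ eφ eΓ)
  sound prov-tag 2F (n ∷ c ∷ a ∷ b ∷ []) (p ∷ []) [] Γ φ eΓ eφ
    with φ | ⌜⌝-invert φ 3 ⟪ a , b ⟫ eφ
  ... | φ₁ ⇒ φ₂ | _ , e with ⟪⟫-injective ⌜ φ₁ ⌝ ⌜ φ₂ ⌝ a b e
  ... | e₁ , e₂ = ⇒I (p (φ₁ ∷ Γ) φ₂ (cong₂ (λ a b → suc ⟪ a , b ⟫) e₁ eΓ) e₂)
  sound prov-tag 3F (n ∷ c ∷ a ∷ b ∷ []) ((φ , e) ∷ p ∷ q ∷ []) [] Γ ψ eΓ eψ =
    ⇒E (p Γ (φ ⇒ ψ) eΓ (cong₂ (λ a b → ⟪ 3 , ⟪ a , b ⟫ ⟫) e eψ)) (q Γ φ eΓ e)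
  sound prov-tag 4F (n ∷ c ∷ a ∷ []) (p ∷ []) [] Γ φ eΓ eφ =
    raa (p (¬' φ ∷ Γ) ⊥' (cong₂ (λ a b → suc ⟪ ⟪ 3 , ⟪ a , ⟪ 0 , 0 ⟫ ⟫ ⟫ , b ⟫) eφ eΓ) refl)
  sound prov-tag 5F (n ∷ c ∷ d ∷ a ∷ []) (p ∷ q ∷ []) [] Γ φ eΓ eφ with φ | ⌜⌝-invert φ 4 a eφ
  ... | ∀' ψ | _ , e = ∀I (q (map shift Γ) ψ (p Γ eΓ) e)
  sound prov-tag 6F (n ∷ c ∷ a ∷ t ∷ b ∷ []) ((φ , e) ∷ (u , e′) ∷ p ∷ q ∷ []) [] Γ ψ eΓ eψ =
    ≡-subst (T ∣ Γ ⊢_)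
      (⌜⌝-injective _ ψ (trans (p (instantiation u) φ (cong ⟪ 1 ,_⟫ e′) e) (sym eψ)))
      (∀E (q Γ (∀' φ) eΓ (cong ⟪ 4 ,_⟫ e)) u)
  sound diag-tag 0F (x ∷ t ∷ y ∷ []) (p ∷ q ∷ r ∷ []) [] ψ e =
    r [] (¬' (ψ [ numeral x ])) refl
      (cong (λ a → ⟪ 3 , ⟪ a , ⟪ 0 , 0 ⟫ ⟫ ⟫) (q (instantiation (numeral x)) ψ (cong ⟪ 1 ,_⟫ p) e))

  -- Completeness

  derive-term : ∀ n (t : Term n) → Derivable term-tag (n ∷ ⌜ t ⌝ₜ ∷ 0 ∷ [])
  derive-term n (var i) with m≤n⇒∃[o]m+o≡n (toℕ<n i)
  ... | e , e′ = ≡-subst (λ n → Derivable term-tag (n ∷ ⟪ 0 , toℕ i ⟫ ∷ 0 ∷ []))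
    (trans (+-suc (toℕ i) e) e′) (node 0F (toℕ i ∷ e ∷ []) [] [])
  derive-term n 𝟎       = node 1F (n ∷ []) [] []
  derive-term n 𝟏       = node 2F (n ∷ []) [] []
  derive-term n (s ⊕ t) = node 3F (n ∷ ⌜ s ⌝ₜ ∷ ⌜ t ⌝ₜ ∷ []) (derive-term n s ∷ derive-term n t ∷ []) []
  derive-term n (s ⊗ t) = node 4F (n ∷ ⌜ s ⌝ₜ ∷ ⌜ t ⌝ₜ ∷ []) (derive-term n s ∷ derive-term n t ∷ []) []

  derive-form : ∀ n (φ : Formula n) → Derivable form-tag (n ∷ ⌜ φ ⌝ ∷ 0 ∷ [])
  derive-form n ⊥'      = node 0F (n ∷ []) [] []
  derive-form n (s ≐ t) = node 1F (n ∷ ⌜ s ⌝ₜ ∷ ⌜ t ⌝ₜ ∷ []) (derive-term n s ∷ derive-term n t ∷ []) []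
  derive-form n (s ≺ t) = node 2F (n ∷ ⌜ s ⌝ₜ ∷ ⌜ t ⌝ₜ ∷ []) (derive-term n s ∷ derive-term n t ∷ []) []
  derive-form n (φ ⇒ ψ) = node 3F (n ∷ ⌜ φ ⌝ ∷ ⌜ ψ ⌝ ∷ []) (derive-form n φ ∷ derive-form n ψ ∷ []) []
  derive-form n (∀' φ)  = node 4F (n ∷ ⌜ φ ⌝ ∷ []) (derive-form (suc n) φ ∷ []) []

  Subₜ : Substitution n m → Term n → Set
  Subₜ s t = Derivable subₜ-tag (⌜ s ⌝ₛ ∷ ⌜ t ⌝ₜ ∷ ⌜ substₜ ⟦ s ⟧ t ⌝ₜ ∷ [])

  -- The clause for variables under a lifting needs weakening applied to an
  -- arbitrary term, so weakening is treated first.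
  substₜ-by : (s : Substitution n m) → (∀ i → Subₜ s (var i)) → ∀ t → Subₜ s t
  substₜ-by s h (var i) = h i
  substₜ-by s h 𝟎       = node 5F (⌜ s ⌝ₛ ∷ []) [] []
  substₜ-by s h 𝟏       = node 6F (⌜ s ⌝ₛ ∷ []) [] []
  substₜ-by s h (t ⊕ u) = node 7F
    (⌜ s ⌝ₛ ∷ ⌜ t ⌝ₜ ∷ ⌜ u ⌝ₜ ∷ ⌜ substₜ ⟦ s ⟧ t ⌝ₜ ∷ ⌜ substₜ ⟦ s ⟧ u ⌝ₜ ∷ [])
    (substₜ-by s h t ∷ substₜ-by s h u ∷ []) []
  substₜ-by s h (t ⊗ u) = node 8F
    (⌜ s ⌝ₛ ∷ ⌜ t ⌝ₜ ∷ ⌜ u ⌝ₜ ∷ ⌜ substₜ ⟦ s ⟧ t ⌝ₜ ∷ ⌜ substₜ ⟦ s ⟧ u ⌝ₜ ∷ [])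
    (substₜ-by s h t ∷ substₜ-by s h u ∷ []) []

  derive-shiftₜ : (t : Term n) → Subₜ weakening t
  derive-shiftₜ = substₜ-by weakening λ i → node 0F (toℕ i ∷ []) [] []

  derive-substₜ : (s : Substitution n m) → ∀ t → Subₜ s t
  derive-var    : (s : Substitution n m) → ∀ i → Subₜ s (var i)
  derive-substₜ s = substₜ-by s (derive-var s)
  derive-var weakening         i       = derive-shiftₜ (var i)
  derive-var (instantiation t) zero    = node 1F (⌜ t ⌝ₜ ∷ []) [] []
  derive-var (instantiation t) (suc i) = node 2F (⌜ t ⌝ₜ ∷ toℕ i ∷ []) [] []
  derive-var (lifting s)       zero    = node 3F (⌜ s ⌝ₛ ∷ []) [] []
  derive-var (lifting s)       (suc i) = node 4F
    (⌜ s ⌝ₛ ∷ toℕ i ∷ ⌜ ⟦ s ⟧ i ⌝ₜ ∷ ⌜ shiftₜ (⟦ s ⟧ i) ⌝ₜ ∷ [])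
    (derive-var s i ∷ derive-shiftₜ (⟦ s ⟧ i) ∷ []) []

  derive-subst : (s : Substitution n m) (φ : Formula n) →
                 Derivable sub-tag (⌜ s ⌝ₛ ∷ ⌜ φ ⌝ ∷ ⌜ subst ⟦ s ⟧ φ ⌝ ∷ [])
  derive-subst s ⊥'      = node 0F (⌜ s ⌝ₛ ∷ []) [] []
  derive-subst s (t ≐ u) = node 1F
    (⌜ s ⌝ₛ ∷ ⌜ t ⌝ₜ ∷ ⌜ u ⌝ₜ ∷ ⌜ substₜ ⟦ s ⟧ t ⌝ₜ ∷ ⌜ substₜ ⟦ s ⟧ u ⌝ₜ ∷ [])
    (derive-substₜ s t ∷ derive-substₜ s u ∷ []) []
  derive-subst s (t ≺ u) = node 2F
    (⌜ s ⌝ₛ ∷ ⌜ t ⌝ₜ ∷ ⌜ u ⌝ₜ ∷ ⌜ substₜ ⟦ s ⟧ t ⌝ₜ ∷ ⌜ substₜ ⟦ s ⟧ u ⌝ₜ ∷ [])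
    (derive-substₜ s t ∷ derive-substₜ s u ∷ []) []
  derive-subst s (φ ⇒ ψ) = node 3F
    (⌜ s ⌝ₛ ∷ ⌜ φ ⌝ ∷ ⌜ ψ ⌝ ∷ ⌜ subst ⟦ s ⟧ φ ⌝ ∷ ⌜ subst ⟦ s ⟧ ψ ⌝ ∷ [])
    (derive-subst s φ ∷ derive-subst s ψ ∷ []) []
  derive-subst s (∀' φ)  = node 4F (⌜ s ⌝ₛ ∷ ⌜ φ ⌝ ∷ ⌜ subst (lift ⟦ s ⟧) φ ⌝ ∷ [])
    (derive-subst (lifting s) φ ∷ []) []

  derive-shift : (Γ : List (Formula n)) →
                 Derivable shift-tag (⌜ Γ ⌝ᶜ ∷ ⌜ map shift Γ ⌝ᶜ ∷ 0 ∷ [])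
  derive-shift []      = node 0F [] [] []
  derive-shift (φ ∷ Γ) = node 1F (⌜ φ ⌝ ∷ ⌜ shift φ ⌝ ∷ ⌜ Γ ⌝ᶜ ∷ ⌜ map shift Γ ⌝ᶜ ∷ [])
    (derive-subst weakening φ ∷ derive-shift Γ ∷ []) []

  derive-mem : {φ : Formula n} {Γ : List (Formula n)} → φ ∈ˡ Γ →
               Derivable mem-tag (⌜ φ ⌝ ∷ ⌜ Γ ⌝ᶜ ∷ 0 ∷ [])
  derive-mem {φ = φ} {_ ∷ Γ} (here refl) = node 0F (⌜ φ ⌝ ∷ ⌜ Γ ⌝ᶜ ∷ []) [] []
  derive-mem {φ = φ} {ψ ∷ Γ} (there p)   =
    node 1F (⌜ φ ⌝ ∷ ⌜ ψ ⌝ ∷ ⌜ Γ ⌝ᶜ ∷ []) (derive-mem p ∷ []) []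

  derive-num : ∀ a → Derivable num-tag (a ∷ ⌜ numeral {0} a ⌝ₜ ∷ 0 ∷ [])
  derive-num zero          = node 0F [] [] []
  derive-num (suc zero)    = node 1F [] [] []
  derive-num (suc (suc a)) = node 2F (a ∷ ⌜ numeral {0} (suc a) ⌝ₜ ∷ []) (derive-num (suc a) ∷ []) []

  derive-prov : {Γ : List (Formula n)} {φ : Formula n} → T ∣ Γ ⊢ φ →
                Derivable prov-tag (n ∷ ⌜ Γ ⌝ᶜ ∷ ⌜ φ ⌝ ∷ [])
  derive-prov {n} {Γ} (ax {φ = φ} p) = node 0F (n ∷ ⌜ Γ ⌝ᶜ ∷ ⌜ embed φ ⌝ ∷ []) []
    (≡-subst (λ a → a ∷ [] ⊨ σ) (sym (⌜embed⌝ φ)) p ∷ [])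
  derive-prov {n} {Γ} {φ} (hyp p) = node 1F (n ∷ ⌜ Γ ⌝ᶜ ∷ ⌜ φ ⌝ ∷ []) (derive-mem p ∷ []) []
  derive-prov {n} {Γ} (⇒I {φ = φ} {ψ} d) = node 2F (n ∷ ⌜ Γ ⌝ᶜ ∷ ⌜ φ ⌝ ∷ ⌜ ψ ⌝ ∷ [])
    (derive-prov d ∷ []) []
  derive-prov {n} {Γ} (⇒E {φ = φ} {ψ} d e) = node 3F (n ∷ ⌜ Γ ⌝ᶜ ∷ ⌜ φ ⌝ ∷ ⌜ ψ ⌝ ∷ [])
    (derive-form n φ ∷ derive-prov d ∷ derive-prov e ∷ []) []
  derive-prov {n} {Γ} {φ} (raa d) = node 4F (n ∷ ⌜ Γ ⌝ᶜ ∷ ⌜ φ ⌝ ∷ []) (derive-prov d ∷ []) []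
  derive-prov {n} {Γ} (∀I {φ = φ} d) = node 5F (n ∷ ⌜ Γ ⌝ᶜ ∷ ⌜ map shift Γ ⌝ᶜ ∷ ⌜ φ ⌝ ∷ [])
    (derive-shift Γ ∷ derive-prov d ∷ []) []
  derive-prov {n} {Γ} (∀E {φ = φ} d t) =
    node 6F (n ∷ ⌜ Γ ⌝ᶜ ∷ ⌜ φ ⌝ ∷ ⌜ t ⌝ₜ ∷ ⌜ φ [ t ] ⌝ ∷ [])
      (derive-form (suc n) φ ∷ derive-term n t ∷ derive-subst (instantiation t) φ ∷ derive-prov d ∷ []) []

  -- Diagonalisation

  refutable : Formula 1
  refutable = derivable diag-tag (x₀ ∷ 𝟎 ∷ 𝟎 ∷ [])

  Σ₁-refutable : Σ₁ refutable
  Σ₁-refutable = Σ₁-derivable diag-tag (x₀ ∷ 𝟎 ∷ 𝟎 ∷ [])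

  refutable⁺ : ∀ ψ → T ⊢ ¬' (ψ [ numeral ⌜ ψ ⌝ ]) → ⌜ ψ ⌝ ∷ [] ⊨ refutable
  refutable⁺ ψ d = derivable⁺ diag-tag (x₀ ∷ 𝟎 ∷ 𝟎 ∷ []) (⌜ ψ ⌝ ∷ [])
    (node 0F (⌜ ψ ⌝ ∷ ⌜ numeral {0} ⌜ ψ ⌝ ⌝ₜ ∷ ⌜ ψ [ numeral ⌜ ψ ⌝ ] ⌝ ∷ [])
      (derive-num ⌜ ψ ⌝ ∷ derive-subst (instantiation (numeral ⌜ ψ ⌝)) ψ ∷ derive-prov d ∷ []) [])

  refutable⁻ : ∀ ψ → ⌜ ψ ⌝ ∷ [] ⊨ refutable → ¬ ¬ (T ⊢ ¬' (ψ [ numeral ⌜ ψ ⌝ ]))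
  refutable⁻ ψ h ¬d = derivable⁻ diag-tag (x₀ ∷ 𝟎 ∷ 𝟎 ∷ []) (⌜ ψ ⌝ ∷ []) h λ d →
    ¬d (eliminate Meaning sound d ψ refl)

-- Undecidability of the diagonal sentence

theorem2p3 : ∀ {ℓ} (T : Theory ℓ) → Δ₁-Definable T → Σ₁-Sound T → StrongerThan T R₀ → Incomplete T
theorem2p3 T (σ , _ , Σ₁-σ , _ , _ , defines) Σ₁-sound R₀⊆T = φ , unprovable , irrefutable
  where
  coded : ∀ {a} → a ∷ [] ⊨ σ → ∃ λ (χ : Sentence) → ⌜ χ ⌝ ≡ a
  coded h with χ , _ , e ← Equivalence.to (defines _) h = χ , e

  open Provability Σ₁-σ coded renaming (T to T′)

  T⊆T′ : T ⊆ T′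
  T⊆T′ p = Equivalence.from (defines _) (_ , p , refl)

  T′⊆T : T′ ⊆ T
  T′⊆T {φ} h with χ , p , e ← Equivalence.to (defines ⌜ φ ⌝) h =
    ≡-subst T (⌜⌝-injective χ φ e) p

  φ : Sentence
  φ = refutable [ numeral ⌜ refutable ⌝ ]

  Σ₁-φ : Σ₁ φ
  Σ₁-φ = Σ₁-subst _ Σ₁-refutable

  denotes : ∀ i → lookup (⌜ refutable ⌝ ∷ []) i ≡ evalₜ [] (inst (numeral ⌜ refutable ⌝) i)
  denotes zero = sym (evalₜ-numeral [] ⌜ refutable ⌝)

  consistent : ¬ (T ⊢ ⊥')
  -- Falsity is itself a Σ₁ sentence, so soundness includes consistency.
  consistent = Σ₁-sound ⊥' (base bot)

  unprovable : ¬ (T ⊢ φ)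
  -- A provable `φ` is true by soundness, and its truth says that it is refutable.
  unprovable d = refutable⁻ refutable (⊨-subst⁻ denotes refutable (Σ₁-sound φ Σ₁-φ d))
    λ d′ → consistent (⇒E (⊢-mono T′⊆T d′) d)

  irrefutable : ¬ (T ⊢ ¬' φ)
  -- A refutation of `φ` makes `φ` true, hence provable by Σ₁-completeness up to double negation.
  irrefutable d = Completeness.Σ₁-complete R₀⊆T Σ₁-φ {ρ = []} (λ ())
    (⊨-subst⁺ denotes refutable (refutable⁺ refutable (⊢-mono T⊆T′ d)))
    λ d′ → consistent (⇒E d d′)
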